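{- There exists $n_0$ such that for all $n\ge n_0$ the following holds. Let $\mathbf{T}=\{T_c: c\in[n]\}$ be a collection of $n$ tournaments on a common vertex set $V$ with $|V|=n$ (so the color set is $[n]$), and let $P$ be an oriented path on $n$ vertices all of whose blocks have length at most $(\log_2 n)^{1/2}$. Then $\mathbf{T}$ contains an $[n-1]$-rainbow copy $Q=v_1\dots v_n$ of $P$ such that the arc $v_1\to v_n$ belongs to $T_n$.
   Context: An oriented path $P=v_1\dots v_{\ell+1}$ is a sequence of distinct vertices with, for each $i\in[\ell]$, an arc between $v_i$ and $v_{i+1}$ in a prescribed direction; its length is $\ell$. It is directed if all arcs go $v_i\to v_{i+1}$ or all go $v_{i+1}\to v_i$. A block of $P$ is a maximal directed subpath; its length is its number of arcs. For a collection $\mathbf{T}=\{T_c:c\in\Gamma\}$ of tournaments on a common vertex set and a set $C$ of colors, a $C$-rainbow copy of $P$ is a copy of $P$ on vertices of $V$ together with an injective map $\varphi$ from its arcs to $C$ such that each arc $e$ lies in $T_{\varphi(e)}$. -}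

module Defs where

open import Data.Nat using (ℕ; zero; suc; _+_; _*_; _^_; _≤_; _<_)
open import Data.Fin using (Fin; fromℕ<; inject₁; fromℕ) renaming (zero to fzero; suc to fsuc)
open import Data.Bool using (Bool; true; false)
open import Data.Sum using (_⊎_)
open import Data.Product using (Σ; _×_; _,_)
open import Function.Definitions using (Injective)
open import Relation.Binary.PropositionalEquality using (_≡_; _≢_)

-- A tournament on vertex set Fin n, as a Boolean adjacency relation:
-- T u v ≡ true means the arc u → v is present.
-- Loopless; for distinct u, v exactly one of u → v, v → u is present.
record IsTournament {n : ℕ} (T : Fin n → Fin n → Bool) : Set where
  field
    irrefl : ∀ u → T u u ≡ false
    total  : ∀ u v → u ≢ v → (T u v ≡ true) ⊎ (T v u ≡ true)
    asym   : ∀ u v → T u v ≡ true → T v u ≡ false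

-- An oriented path of length m (on m+1 vertices v₀ … v_m) is given by
-- its orientation  o : Fin m → Bool :  o i ≡ true  means the i-th arc is
-- v_i → v_{i+1},  o i ≡ false  means v_{i+1} → v_i.
OrientedPath : ℕ → Set
OrientedPath m = Fin m → Bool

arcDir : ∀ {m} → OrientedPath m → (j : ℕ) → j < m → Bool
arcDir o j p = o (fromℕ< p)

record IsBlock {m : ℕ} (o : OrientedPath m) (i L : ℕ) : Set where
  field
    nonempty : 1 ≤ L
    inRange  : i + L ≤ m
    directed : ∀ j k (pj : j < m) (pk : k < m) →
               i ≤ j → j < i + L → i ≤ k → k < i + L →
               arcDir o j pj ≡ arcDir o k pk
    maxLeft  : ∀ j (pj : j < m) (pi : i < m) → suc j ≡ i →
               arcDir o j pj ≢ arcDir o i pi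
    maxRight : ∀ (pk : i + L < m) (pi : i < m) →
               arcDir o (i + L) pk ≢ arcDir o i pi

ArcIn : ∀ {n m} → OrientedPath m → (Fin n → Fin n → Bool) →
        (v : Fin (suc m) → Fin n) → Fin m → Set
ArcIn o T v i with o i
... | true  = T (v (inject₁ i)) (v (fsuc i)) ≡ true
... | false = T (v (fsuc i)) (v (inject₁ i)) ≡ true

-- A C-rainbow copy of the oriented path o (on m+1 vertices) in the collection
-- T : colours → tournaments on Fin n, where the colour set C is given by the
-- injective embedding  col : Fin k → colours:
-- an injective vertex map v and an injective colouring φ of the arcs by C
-- such that arc i lies in T (col (φ i)).
record RainbowCopy {n m k : ℕ} {Γ : Set} (T : Γ → Fin n → Fin n → Bool)
                   (col : Fin k → Γ) (o : OrientedPath m)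
                   (v : Fin (suc m) → Fin n) (φ : Fin m → Fin k) : Set where
  field
    v-inj   : Injective _≡_ _≡_ v
    φ-inj   : Injective _≡_ _≡_ φ
    arcs-ok : ∀ i → ArcIn o (T (col (φ i))) v i

{-# OPTIONS --safe #-}
module Submission where

-- A path is built from left to right while keeping a list of candidates for its next
-- vertex.  Following the orientation inside the list halves it at every arc, but since
-- any k consecutive arcs contain both orientations, the path can pass from any list of
-- candidates to any other large list A: in a given colour, either many arcs lead from the
-- candidates to A or many lead back, and both kinds of arc occur.  So the candidates can
-- always be renewed, and the greedy construction only stops when few vertices remain.
--
-- Exactness is achieved by absorption.  An arc between two vertices s₁, s₂ that are both
-- joined alike to the rest of the path can take any colour, by exchanging s₁ and s₂.  For
-- vertices, reserve a set D of colours, consider the majority digraph of D, and place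
-- near a suitable block of the path a transitive subtournament: any further vertex x can be
-- inserted there, at the source, at the sink or in the interior of the block, and the
-- arcs are then coloured greedily from D.  The unused colours of D are absorbed by the
-- first kind of gadget, which therefore precedes the second kind on the path; the arc
-- v₁ → v_n is obtained by reserving out-neighbours of v₁ for the last jump.

open import Defs
open import Data.Nat using (ℕ; zero; suc; _+_; _*_; _∸_; _^_; _≤_; _<_; z≤n; s≤s; _≤?_; _<?_; _<ᵇ_; NonZero; >-nonZero)
open import Data.Nat.Properties
open import Data.Nat.ListAction using (sum)
open import Data.Nat.Tactic.RingSolver using (solve-∀)
open import Data.Fin using (Fin; inject₁; fromℕ) renaming (zero to fzero; suc to fsuc)
import Data.Bool as Bool
open import Data.Bool using (Bool; true; false; not)
open import Data.Bool.Properties using (T-≡; ¬-not)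
open import Data.Product using (_×_; _,_; proj₁; proj₂; ∃-syntax)
open import Data.Sum using (_⊎_; inj₁; inj₂)
open import Data.Empty using (⊥; ⊥-elim)
open import Data.List using (List; []; _∷_; _++_; [_]; length; take; drop; replicate; map; reverse; tabulate; allFin)
open import Data.List.Properties using (length-++; length-take; length-replicate; length-reverse; length-tabulate; take++drop≡id; ++-assoc; ++-identityʳ; unfold-reverse; ∷-injectiveˡ; ∷-injectiveʳ)
open import Data.List.Membership.Propositional using (_∈_; find)
open import Data.List.Membership.Propositional.Properties using (∈-∃++; ∈-++⁺ˡ; ∈-++⁺ʳ)
open import Data.List.Relation.Unary.Any using (here; there; any?)
open import Data.List.Relation.Unary.All as All using (All; []; _∷_)
import Data.List.Relation.Unary.All.Properties as AllP
open import Data.List.Relation.Unary.AllPairs using (AllPairs; []; _∷_)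
open import Data.List.Relation.Unary.Unique.Propositional using (Unique)
open import Data.List.Relation.Unary.Unique.Propositional.Properties using (allFin⁺)
open import Data.List.Relation.Binary.Permutation.Propositional using (_↭_; ↭-refl; ↭-sym; ↭-trans; ↭-reflexive; prep; swap; module PermutationReasoning)
import Data.List.Relation.Binary.Permutation.Propositional as Perm
import Data.List.Relation.Binary.Permutation.Propositional.Properties as PermP
open import Function.Bundles using (Equivalence)
open import Relation.Nullary using (¬_; Dec; yes; no)
open import Relation.Binary.PropositionalEquality using (_≡_; _≢_; refl; sym; trans; cong; cong₂; subst; subst₂; module ≡-Reasoning)
import Algebra.Solver.CommutativeMonoid as CommutativeMonoidSolver

module ↭-Solver {X : Set} = CommutativeMonoidSolver (PermP.++-commutativeMonoid {A = X})
open ↭-Solver using (_⊕_; _⊜_) renaming (solve to ↭-solve)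

-- Lists, permutations and uniqueness

private variable
  X : Set

unique-resp-↭ : {xs ys : List X} → xs ↭ ys → Unique xs → Unique ys
unique-resp-↭ Perm.refl u = u
unique-resp-↭ (prep x p) (a ∷ u) = PermP.All-resp-↭ p a ∷ unique-resp-↭ p u
unique-resp-↭ (swap x y p) ((x≢y ∷ ax) ∷ (ay ∷ u)) =
  ((λ y≡x → x≢y (sym y≡x)) ∷ PermP.All-resp-↭ p ay) ∷ PermP.All-resp-↭ p ax ∷ unique-resp-↭ p u
unique-resp-↭ (Perm.trans p q) u = unique-resp-↭ q (unique-resp-↭ p u)

unique-++ˡ : ∀ xs {ys : List X} → Unique (xs ++ ys) → Unique xs
unique-++ˡ [] u = []
unique-++ˡ (x ∷ xs) (a ∷ u) = AllP.++⁻ˡ xs a ∷ unique-++ˡ xs u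

unique-++ʳ : ∀ xs {ys : List X} → Unique (xs ++ ys) → Unique ys
unique-++ʳ [] u = u
unique-++ʳ (x ∷ xs) (a ∷ u) = unique-++ʳ xs u

unique-++-≢ : ∀ xs {ys : List X} {x y : X} → Unique (xs ++ ys) → x ∈ xs → y ∈ ys → x ≢ y
unique-++-≢ (x ∷ xs) (a ∷ u) (here refl) y∈ = All.lookup (AllP.++⁻ʳ xs a) y∈
unique-++-≢ (x ∷ xs) (a ∷ u) (there x∈) y∈ = unique-++-≢ xs u x∈ y∈

↭-pick : {xs : List X} {x : X} → x ∈ xs → ∃[ ys ] xs ↭ x ∷ ys
↭-pick {x = x} x∈ with ys , zs , refl ← ∈-∃++ x∈ = ys ++ zs , PermP.shift x ys zs

trim : ∀ q (xs : List X) → q ≤ length xs →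
       ∃[ ys ] ∃[ zs ] xs ≡ ys ++ zs × length ys ≡ q
trim q xs q≤ = take q xs , drop q xs , sym (take++drop≡id q xs) ,
  trans (length-take q xs) (m≤n⇒m⊓n≡m q≤)

-- Counting

bit : Bool → ℕ
bit true = 1
bit false = 0

count : (X → Bool) → List X → ℕ
count p [] = 0
count p (x ∷ xs) = bit (p x) + count p xs

count-resp-↭ : (p : X → Bool) {xs ys : List X} → xs ↭ ys → count p xs ≡ count p ys
count-resp-↭ p Perm.refl = refl
count-resp-↭ p (prep x r) = cong (bit (p x) +_) (count-resp-↭ p r)
count-resp-↭ p (swap {xs} {ys} x y r) rewrite count-resp-↭ p r = lemma (bit (p x)) (bit (p y)) (count p ys)
  where
  lemma : ∀ a b c → a + (b + c) ≡ b + (a + c)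
  lemma = solve-∀
count-resp-↭ p (Perm.trans r s) = trans (count-resp-↭ p r) (count-resp-↭ p s)

count-++ : (p : X → Bool) (xs ys : List X) → count p (xs ++ ys) ≡ count p xs + count p ys
count-++ p [] ys = refl
count-++ p (x ∷ xs) ys rewrite count-++ p xs ys = sym (+-assoc (bit (p x)) _ _)

count≤length : (p : X → Bool) (xs : List X) → count p xs ≤ length xs
count≤length p [] = z≤n
count≤length p (x ∷ xs) = +-mono-≤ (bit≤1 (p x)) (count≤length p xs)
  where
  bit≤1 : ∀ b → bit b ≤ 1
  bit≤1 true = ≤-refl
  bit≤1 false = z≤n

count-zero : (p : X → Bool) (xs : List X) → (∀ x → p x ≡ false) → count p xs ≡ 0
count-zero p [] h = refl
count-zero p (x ∷ xs) h rewrite h x = count-zero p xs h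

count-pos : (p : X → Bool) (xs : List X) → 1 ≤ count p xs → ∃[ x ] x ∈ xs × p x ≡ true
count-pos p (x ∷ xs) h with p x in eq
... | true = x , here refl , eq
... | false with y , y∈ , py ← count-pos p xs h = y , there y∈ , py

length≤count+count : (p r : X → Bool) (xs : List X) →
                     All (λ x → p x ≡ true ⊎ r x ≡ true) xs → length xs ≤ count p xs + count r xs
length≤count+count p r [] [] = z≤n
length≤count+count p r (x ∷ xs) (h ∷ hs) = ≤-trans
  (+-mono-≤ (one h) (length≤count+count p r xs hs))
  (≤-reflexive (lemma (bit (p x)) (bit (r x)) (count p xs) (count r xs)))
  where
  lemma : ∀ a b c d → (a + b) + (c + d) ≡ (a + c) + (b + d)
  lemma = solve-∀
  one : p x ≡ true ⊎ r x ≡ true → 1 ≤ bit (p x) + bit (r x)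
  one (inj₁ e) rewrite e = s≤s z≤n
  one (inj₂ e) rewrite e = m≤n+m 1 (bit (p x))

select : (p : X → Bool) (xs : List X) →
         ∃[ ys ] ∃[ zs ] xs ↭ ys ++ zs × length ys ≡ count p xs × All (λ x → p x ≡ true) ys
select p [] = [] , [] , ↭-refl , refl , []
select p (x ∷ xs) with select p xs
... | ys , zs , r , l , a with p x in eq
... | true = x ∷ ys , zs , prep x r , cong suc l , eq ∷ a
... | false = ys , x ∷ zs , ↭-trans (prep x r) (↭-sym (PermP.shift x ys zs)) , l , a

Σ[_]_ : List X → (X → ℕ) → ℕ
Σ[ xs ] f = sum (map f xs)

Σ-zero : (xs : List X) → Σ[ xs ] (λ _ → 0) ≡ 0
Σ-zero [] = refl
Σ-zero (x ∷ xs) = Σ-zero xs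

Σ-+ : (f g : X → ℕ) (xs : List X) → Σ[ xs ] (λ x → f x + g x) ≡ (Σ[ xs ] f) + (Σ[ xs ] g)
Σ-+ f g [] = refl
Σ-+ f g (x ∷ xs) rewrite Σ-+ f g xs = lemma (f x) (g x) (Σ[ xs ] f) (Σ[ xs ] g)
  where
  lemma : ∀ a b c d → (a + b) + (c + d) ≡ (a + c) + (b + d)
  lemma = solve-∀

Σ-mono : (f : X → ℕ) (c : ℕ) (xs : List X) → All (λ x → f x ≤ c) xs → Σ[ xs ] f ≤ length xs * c
Σ-mono f c [] [] = z≤n
Σ-mono f c (x ∷ xs) (h ∷ hs) = +-mono-≤ h (Σ-mono f c xs hs)

Σ-bound : (f : X → ℕ) (c : ℕ) (xs : List X) → All (λ x → c ≤ f x) xs → length xs * c ≤ Σ[ xs ] f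
Σ-bound f c [] [] = z≤n
Σ-bound f c (x ∷ xs) (h ∷ hs) = +-mono-≤ h (Σ-bound f c xs hs)

Σ-count-swap : (R : X → X → Bool) (xs ys : List X) →
               Σ[ xs ] (λ x → count (R x) ys) ≡ Σ[ ys ] (λ y → count (λ x → R x y) xs)
Σ-count-swap R [] ys = sym (Σ-zero ys)
Σ-count-swap R (x ∷ xs) ys rewrite Σ-count-swap R xs ys =
  trans (cong (_+ _) (count≡Σ (R x) ys)) (sym (Σ-+ (λ y → bit (R x y)) _ ys))
  where
  count≡Σ : (p : X → Bool) (zs : List X) → count p zs ≡ Σ[ zs ] (λ z → bit (p z))
  count≡Σ p [] = refl
  count≡Σ p (z ∷ zs) = cong (bit (p z) +_) (count≡Σ p zs)

-- Semicomplete digraphs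

-- A common frame for tournaments, their reversals and the majority digraphs of a set of colours.
record Semicomplete {V : Set} (R : V → V → Bool) : Set where
  field
    irreflexive : ∀ u → R u u ≡ false
    total : ∀ {u v} → u ≢ v → R u v ≡ true ⊎ R v u ≡ true
open Semicomplete public

-- An arc traversed backwards is a forward arc of the reversed digraph, so each lemma on outdegrees
-- serves both orientations.
dir : {V : Set} → Bool → (V → V → Bool) → V → V → Bool
dir true  R u v = R u v
dir false R u v = R v u

Arc : {V : Set} → Bool → (V → V → Bool) → V → V → Set
Arc b R u v = dir b R u v ≡ true

dir-semicomplete : {V : Set} {R : V → V → Bool} → ∀ b → Semicomplete R → Semicomplete (dir b R)
dir-semicomplete true S = S
dir-semicomplete false S = record
  { irreflexive = irreflexive S
  ; total = λ u≢v → total S (λ v≡u → u≢v (sym v≡u)) }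

Arc-flip : {V : Set} {R : V → V → Bool} → ∀ b {u v} → Arc b R u v → Arc (not b) R v u
Arc-flip true a = a
Arc-flip false a = a

Arc-total : {V : Set} {R : V → V → Bool} → Semicomplete R → ∀ b {u v} → u ≢ v →
            Arc b R u v ⊎ Arc b R v u
Arc-total S b = total (dir-semicomplete b S)

module _ {V : Set} {R : V → V → Bool} (S : Semicomplete R) where

  degree-sum : ∀ U → Unique U → ∀ {u} → u ∈ U →
               length U ≤ suc (count (R u) U + count (λ v → R v u) U)
  degree-sum (x ∷ xs) (a ∷ _) (here refl) rewrite irreflexive S x =
    s≤s (length≤count+count (R x) (λ v → R v x) xs (All.map (total S) a))
  degree-sum (x ∷ xs) (a ∷ U!) {u} (there u∈) = ≤-trans (s≤s (degree-sum xs U! u∈))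
      (s≤s (≤-trans (+-monoˡ-≤ _ one) (≤-reflexive (lemma (bit (R u x)) (bit (R x u)) _ _))))
    where
    lemma : ∀ a b c d → (a + b) + (c + d) ≡ (a + c) + (b + d)
    lemma = solve-∀
    one : 1 ≤ bit (R u x) + bit (R x u)
    one with total S (All.lookup a u∈)
    ... | inj₁ e rewrite e = m≤n+m 1 (bit (R u x))
    ... | inj₂ e rewrite e = s≤s z≤n

  -- Averaging inside U: outdegrees and indegrees have the same sum, so twice the sum of the
  -- outdegrees is at least |U| (|U| - 1). This fails if every outdegree is below q.
  large-outdegree : ∀ q U → Unique U → 1 ≤ q → 2 * q ≤ length U →
    ∃[ u ] ∃[ O ] ∃[ I ] U ↭ u ∷ O ++ I × length O ≡ q × All (λ v → R u v ≡ true) O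
  large-outdegree (suc q) U U! _ 2q≤ with All.all? (λ u → count (R u) U ≤? q) U
  ... | yes small = ⊥-elim (<-irrefl refl (≤-trans bound
          (≤-trans (*-monoʳ-≤ 2 (Σ-mono _ q U small)) (≤-reflexive (lemma (length U) q)))))
    where
    lemma : ∀ l q → 2 * (l * q) ≡ l * (2 * q)
    lemma = solve-∀
    s₁ = Σ[ U ] (λ u → count (R u) U)
    -- Here q is the required outdegree minus one: outdegree plus indegree is at least 2q + 1 at
    -- each vertex, and double counting turns the indegrees into outdegrees.
    double : length U * suc (2 * q) ≤ 2 * s₁
    double = ≤-trans
      (Σ-bound (λ u → count (R u) U + count (λ v → R v u) U) (suc (2 * q)) U
        (All.tabulate λ u∈ → ≤-pred (≤-trans (≤-trans (≤-reflexive (two q)) 2q≤) (degree-sum U U! u∈))))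
      (≤-reflexive (trans (Σ-+ (λ u → count (R u) U) _ U)
        (trans (cong (s₁ +_) (sym (Σ-count-swap R U U))) (cong (s₁ +_) (sym (+-identityʳ s₁))))))
      where
      two : ∀ q → suc (suc (2 * q)) ≡ 2 * suc q
      two = solve-∀
    nonempty : 1 ≤ length U
    nonempty = ≤-trans (s≤s z≤n) 2q≤
    bound : suc (length U * (2 * q)) ≤ 2 * s₁
    bound = ≤-trans (+-monoˡ-≤ _ nonempty) (≤-trans (≤-reflexive (sym (*-suc (length U) (2 * q)))) double)
  ... | no ¬small with u , u∈ , ¬≤ ← find (AllP.¬All⇒Any¬ (λ u → count (R u) U ≤? q) U ¬small)
      with U' , r ← ↭-pick u∈
      with O , I , r' , l , a ← select (R u) U'
      with O₁ , O₂ , refl , l₁ ← trim (suc q) O (≤-trans (≰⇒> ¬≤) (≤-reflexive (trans (count-resp-↭ (R u) r)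
             (trans (cong (λ b → bit b + count (R u) U') (irreflexive S u)) (sym l)))))
      = u , O₁ , O₂ ++ I , ↭-trans r (prep u (↭-trans r' (↭-reflexive (++-assoc O₁ O₂ I)))) , l₁ , AllP.++⁻ˡ O₁ a

-- Rainbow paths

module Rainbow {V C : Set} (T : C → V → V → Bool) (TS : ∀ c → Semicomplete (T c)) (End : V → Set) where

  -- Path N w cs vs: a rainbow path with vertices vs, orientations w and colours cs that
  -- starts in N and ends in End.  Each arc joins its tail to a whole list of candidates
  -- for the next vertex, which makes initial segments easy to prepend.
  data Path (N : List V) : List Bool → List C → List V → Set where
    end  : ∀ {v} → v ∈ N → End v → Path N [] [] (v ∷ [])
    step : ∀ {b w c cs u vs N'} → u ∈ N → All (Arc b (T c) u) N' → Path N' w cs vs →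
           Path N (b ∷ w) (c ∷ cs) (u ∷ vs)

  Path-mono : ∀ {N N' w cs vs} → (∀ {v} → v ∈ N → v ∈ N') → Path N w cs vs → Path N' w cs vs
  Path-mono N⊆N' (end v∈ e) = end (N⊆N' v∈) e
  Path-mono N⊆N' (step u∈ a p) = step (N⊆N' u∈) a p

  Path-length : ∀ {N w cs vs} → Path N w cs vs → length vs ≡ suc (length w) × length cs ≡ length w
  Path-length (end _ _) = refl , refl
  Path-length (step _ _ p) with l , l' ← Path-length p = cong suc l , cong suc l'

  -- An initial segment is encoded as the operation of prepending it, so that concatenating segments
  -- is composing functions.
  Connects : List V → List Bool → List C → List V → List V → Set
  Connects N w cs us N' = ∀ {w' cs' vs} → Path N' w' cs' vs → Path N (w ++ w') (cs ++ cs') (us ++ vs)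

  Connects-++ : ∀ {N w₁ cs₁ us₁ N' w₂ cs₂ us₂ N''} →
    Connects N w₁ cs₁ us₁ N' → Connects N' w₂ cs₂ us₂ N'' →
    Connects N (w₁ ++ w₂) (cs₁ ++ cs₂) (us₁ ++ us₂) N''
  Connects-++ {w₁ = w₁} {cs₁} {us₁} {w₂ = w₂} {cs₂} {us₂} f g {w'} {cs'} {vs} p
    rewrite ++-assoc w₁ w₂ w' | ++-assoc cs₁ cs₂ cs' | ++-assoc us₁ us₂ vs = f (g p)

  -- No vertex is lost: what the route does not use stays in `next` or `rest`. The colours agree
  -- only up to order, because a jump reserves one of them for an arc whose position is found later.
  -- Z records where the new candidates come from.
  record Advance (N A Z : List V) (w : List Bool) (cs : List C) (q : ℕ) : Set where
    field
      route          : List V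
      colours        : List C
      next rest      : List V
      vertices↭      : N ++ A ↭ route ++ next ++ rest
      colours↭       : colours ↭ cs
      route-length   : length route ≡ length w
      next-length    : length next ≡ q
      next⊆          : ∀ {v} → v ∈ next → v ∈ Z
      connects       : Connects N w colours route next
  open Advance public

  Advance-unique : ∀ {N A Z w cs q} (a : Advance N A Z w cs q) → Unique (N ++ A) → Unique (next a ++ rest a)
  Advance-unique a U! = unique-++ʳ (route a) (unique-resp-↭ (vertices↭ a) U!)

  Advance-cast : ∀ {N A Z w w' cs cs' q} → w ≡ w' → cs ↭ cs' → Advance N A Z w cs q → Advance N A Z w' cs' q
  Advance-cast refl r a = record
    { route = route a ; colours = colours a ; next = next a ; rest = rest a
    ; vertices↭ = vertices↭ a
    ; colours↭ = ↭-trans (colours↭ a) r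
    ; route-length = route-length a
    ; next-length = next-length a
    ; next⊆ = next⊆ a
    ; connects = connects a }

  Advance-++ : ∀ {N A Z Z' w₁ cs₁ q₁ w₂ cs₂ q₂} (a : Advance N A Z w₁ cs₁ q₁) →
    Advance (next a) (rest a) Z' w₂ cs₂ q₂ → Advance N A Z' (w₁ ++ w₂) (cs₁ ++ cs₂) q₂
  Advance-++ {w₁ = w₁} {w₂ = w₂} a b = record
    { route = route a ++ route b ; colours = colours a ++ colours b ; next = next b ; rest = rest b
    ; vertices↭ = ↭-trans (vertices↭ a) (↭-trans (PermP.++⁺ˡ (route a) (vertices↭ b))
        (↭-reflexive (sym (++-assoc (route a) (route b) _))))
    ; colours↭ = PermP.++⁺ (colours↭ a) (colours↭ b)
    ; route-length = trans (length-++ (route a)) (trans (cong₂ _+_ (route-length a) (route-length b)) (sym (length-++ w₁)))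
    ; next-length = next-length b
    ; next⊆ = next⊆ b
    ; connects = Connects-++ (connects a) (connects b) }

  -- Each arc starts at a vertex of large outdegree in the current list and keeps its out-neighbours
  -- only, which halves the list.
  walk : ∀ w cs N A q → length cs ≡ length w → Unique N → 1 ≤ q → 2 ^ length w * q ≤ length N →
         Advance N A N w cs q
  walk [] [] N A q _ U! 1≤q q≤ with N' , I , refl , l ← trim q N (≤-trans (≤-reflexive (sym (+-identityʳ q))) q≤) = record
    { route = [] ; colours = [] ; rest = I ++ A ; next = N'
    ; vertices↭ = ↭-reflexive (++-assoc N' I A)
    ; colours↭ = ↭-refl
    ; route-length = refl
    ; next-length = l
    ; next⊆ = ∈-++⁺ˡ
    ; connects = Path-mono ∈-++⁺ˡ }
  walk (b ∷ w) (c ∷ cs) N A q lc U! 1≤q q≤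
    with u , O , I , r , lO , a ← large-outdegree (dir-semicomplete b (TS c)) (2 ^ length w * q) N U!
           (*-mono-≤ (m^n>0 2 (length w)) 1≤q) (≤-trans (≤-reflexive (sym (*-assoc 2 (2 ^ length w) q))) q≤)
    with rec ← walk w cs O (I ++ A) q (suc-injective lc)
           (unique-++ˡ O (unique-++ʳ [ u ] (unique-resp-↭ r U!))) 1≤q (≤-reflexive (sym lO)) = record
    { route = u ∷ route rec ; colours = c ∷ colours rec ; next = next rec ; rest = rest rec
    ; vertices↭ = ↭-trans (PermP.++⁺ʳ A r) (prep u (↭-trans (↭-reflexive (++-assoc O I A)) (vertices↭ rec)))
    ; colours↭ = prep c (colours↭ rec)
    ; route-length = cong suc (route-length rec)
    ; next-length = next-length rec
    ; next⊆ = λ v∈ → PermP.∈-resp-↭ (↭-sym r) (there (∈-++⁺ˡ (next⊆ rec v∈)))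
    ; connects = λ p → step (PermP.∈-resp-↭ (↭-sym r) (here refl)) a (connects rec p) }

  -- The path reaches u inside N, crosses into A by the single arc of colour c, and walks on among
  -- the neighbours of u in A. Candidates of N that are passed over are returned to `rest`.
  hop : ∀ {N A Z} b w₁ w₂ cs₁ cs₂ c q {q₁} → length cs₂ ≡ length w₂ → Unique A → 1 ≤ q →
        (a : Advance N [] Z w₁ cs₁ q₁) → ∀ {u} → u ∈ next a →
        2 ^ length w₂ * q ≤ count (dir b (T c) u) A →
        Advance N A A (w₁ ++ b ∷ w₂) (cs₁ ++ c ∷ cs₂) q
  hop {N} {A} {Z} b w₁ w₂ cs₁ cs₂ c q l U! 1≤q a {u} u∈ deg
    with O , I , r , lO , all ← select (dir b (T c) u) A
    with N₁ , r₁ ← ↭-pick u∈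
    with rec ← walk w₂ cs₂ O (I ++ N₁ ++ rest a) q l (unique-++ˡ O (unique-resp-↭ r U!)) 1≤q
                 (≤-trans deg (≤-reflexive (sym lO))) = record
    { route = route a ++ u ∷ route rec ; colours = colours a ++ c ∷ colours rec ; next = next rec ; rest = rest rec
    ; vertices↭ = begin
        N ++ A                                          ↭⟨ PermP.++⁺ (↭-trans (↭-reflexive (sym (++-identityʳ N))) (vertices↭ a)) r ⟩
        (route a ++ next a ++ rest a) ++ (O ++ I)       ↭⟨ PermP.++⁺ʳ (O ++ I) (PermP.++⁺ˡ (route a) (PermP.++⁺ʳ (rest a) r₁)) ⟩
        (route a ++ (u ∷ N₁) ++ rest a) ++ (O ++ I)     ↭⟨ ↭-solve 6 (λ x y z t o i →
            (x ⊕ ((y ⊕ z) ⊕ t)) ⊕ (o ⊕ i) ⊜ (x ⊕ y) ⊕ (o ⊕ (i ⊕ (z ⊕ t)))) ↭-refl (route a) [ u ] N₁ (rest a) O I ⟩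
        (route a ++ [ u ]) ++ (O ++ I ++ N₁ ++ rest a)  ↭⟨ PermP.++⁺ˡ (route a ++ [ u ]) (vertices↭ rec) ⟩
        (route a ++ [ u ]) ++ (route rec ++ next rec ++ rest rec)
          ↭⟨ ↭-solve 5 (λ x y z t o → (x ⊕ y) ⊕ (z ⊕ (t ⊕ o)) ⊜ (x ⊕ (y ⊕ z)) ⊕ (t ⊕ o)) ↭-refl
               (route a) [ u ] (route rec) (next rec) (rest rec) ⟩
        (route a ++ u ∷ route rec) ++ next rec ++ rest rec ∎
    ; colours↭ = PermP.++⁺ (colours↭ a) (prep c (colours↭ rec))
    ; route-length = trans (length-++ (route a)) (trans (cong₂ _+_ (route-length a) (cong suc (route-length rec)))
        (sym (length-++ w₁)))
    ; next-length = next-length rec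
    ; next⊆ = λ v∈ → PermP.∈-resp-↭ (↭-sym r) (∈-++⁺ˡ (next⊆ rec v∈))
    ; connects = Connects-++ {w₂ = b ∷ w₂} (connects a) (λ p → step u∈ all (connects rec p)) }
    where open PermutationReasoning

  -- Either some candidate u in N has many out-neighbours of colour c in A, and the path
  -- passes from N to A along a forward arc, or all of N has many in-neighbours in A, and
  -- it passes along a backward arc.
  jump : ∀ w cs N A q → (∀ b → b ∈ w) → length cs ≡ length w → Unique (N ++ A) → 1 ≤ q →
         2 ^ length w * 2 ^ length w ≤ length N → 2 * (2 ^ length w * q) ≤ length A →
         Advance N A A w cs q
  jump w [] N A q both lc U! 1≤q _ _ with both true
  jump [] [] N A q both lc U! 1≤q _ _ | ()
  jump (_ ∷ _) [] N A q both () U! 1≤q _ _ | _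
  jump w (c ∷ cs) N A q both lc U! 1≤q N≥ A≥ = go
    where
    h = 2 ^ length w * q

    -- The colour c is kept for the arc into A; the other colours are shared out over the letters
    -- before and after it.
    record Splitting (b : Bool) : Set where
      field
        w₁ w₂ : List Bool
        cs₁ cs₂ : List C
        w≡ : w ≡ w₁ ++ b ∷ w₂
        cs≡ : cs ≡ cs₁ ++ cs₂
        l₁ : length cs₁ ≡ length w₁
        l₂ : length cs₂ ≡ length w₂
    open Splitting

    splitting : ∀ b → Splitting b
    splitting b with w₁ , w₂ , refl ← ∈-∃++ (both b)
      with cs₁ , cs₂ , refl , l ← trim (length w₁) cs (≤-trans (m≤m+n _ (length w₂)) (≤-reflexive (sym (suc-injective
             (trans lc (trans (length-++ w₁) (+-suc _ _)))))))
      = record { w₁ = w₁ ; w₂ = w₂ ; cs₁ = cs₁ ; cs₂ = cs₂ ; w≡ = refl ; cs≡ = refl ; l₁ = l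
               ; l₂ = +-cancelˡ-≡ (length w₁) _ _ (trans (cong (_+ length cs₂) (sym l))
                   (trans (sym (length-++ cs₁)) (suc-injective (trans lc (trans (length-++ w₁) (+-suc _ _)))))) }

    w₁≤ : ∀ {b} (s : Splitting b) → length (w₁ s) ≤ length w
    w₁≤ s = subst (λ x → length (w₁ s) ≤ length x) (sym (w≡ s))
      (≤-trans (m≤m+n _ _) (≤-reflexive (sym (length-++ (w₁ s)))))
    w₂≤ : ∀ {b} (s : Splitting b) → length (w₂ s) ≤ length w
    w₂≤ {b} s = subst (λ x → length (w₂ s) ≤ length x) (sym (w≡ s))
      (≤-trans (≤-trans (n≤1+n _) (m≤n+m _ (length (w₁ s)))) (≤-reflexive (sym (length-++ (w₁ s)))))

    N! = unique-++ˡ N U!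
    A! = unique-++ʳ N U!

    finish : ∀ {b Z q₁} (s : Splitting b) (a : Advance N [] Z (w₁ s) (cs₁ s) q₁) → ∀ {u} → u ∈ next a →
             h ≤ count (dir b (T c) u) A → Advance N A A w (c ∷ cs) q
    finish {b} s a u∈ deg = Advance-cast (sym (w≡ s))
      (↭-trans (PermP.shift c (cs₁ s) (cs₂ s)) (prep c (↭-reflexive (sym (cs≡ s))))) adv
      where
      adv = hop b (w₁ s) (w₂ s) (cs₁ s) (cs₂ s) c q (l₂ s) A! 1≤q a u∈
        (≤-trans (*-monoˡ-≤ q (^-monoʳ-≤ 2 (w₂≤ s))) deg)

    fwd = splitting true
    bwd = splitting false

    -- It keeps 2 ^ |w| candidates, enough for a second walk inside them; this is why N must have
    -- the square of that size.
    stay : Advance N [] N (w₁ fwd) (cs₁ fwd) (2 ^ length w)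
    stay = walk (w₁ fwd) (cs₁ fwd) N [] (2 ^ length w) (l₁ fwd) N! (m^n>0 2 (length w))
      (≤-trans (*-monoˡ-≤ (2 ^ length w) (^-monoʳ-≤ 2 (w₁≤ fwd))) N≥)

    indeg : V → ℕ
    indeg u = count (dir false (T c) u) A

    go : Advance N A A w (c ∷ cs) q
    go with All.all? (λ u → h ≤? indeg u) (next stay)
    ... | no ¬all with u , u∈ , ¬≤ ← find (AllP.¬All⇒Any¬ (λ u → h ≤? indeg u) (next stay) ¬all) =
      -- At least 2h vertices lie in A and fewer than h of them are in-neighbours of u, so at least
      -- h are out-neighbours.
      finish fwd stay u∈ (+-cancelʳ-≤ h _ _ (≤-trans (≤-reflexive (cong (h +_) (sym (+-identityʳ h)))) (≤-trans A≥
        (≤-trans (length≤count+count (T c u) (λ v → T c v u) A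
          (All.tabulate λ v∈ → total (TS c) (unique-++-≢ N U! (next⊆ stay u∈) v∈)))
          (+-monoʳ-≤ (count (T c u) A) (<⇒≤ (≰⇒> ¬≤)))))))
    -- The route of `stay` is given up and only its candidates are kept. A new walk inside them goes
    -- up to a backward arc; whichever vertex it reaches has h in-neighbours in A.
    ... | yes all = finish bwd back u∈back (All.lookup all (next⊆ back u∈back))
      where
      inner = walk (w₁ bwd) (cs₁ bwd) (next stay) [] 1 (l₁ bwd)
        (unique-++ˡ (next stay) (Advance-unique stay (subst Unique (sym (++-identityʳ N)) N!)))
        ≤-refl (≤-trans (*-monoˡ-≤ 1 (^-monoʳ-≤ 2 (w₁≤ bwd))) (≤-reflexive (trans (*-identityʳ _) (sym (next-length stay)))))
      back : Advance N [] (next stay) (w₁ bwd) (cs₁ bwd) 1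
      back = record
        { route = route inner ; colours = colours inner ; next = next inner ; rest = rest inner ++ route stay ++ rest stay
        ; vertices↭ = begin
            N ++ []                                                  ↭⟨ vertices↭ stay ⟩
            route stay ++ next stay ++ rest stay                     ↭⟨ ↭-solve 3 (λ x y z → x ⊕ (y ⊕ z) ⊜ (y ⊕ ↭-Solver.id) ⊕ (x ⊕ z)) ↭-refl
                                                                          (route stay) (next stay) (rest stay) ⟩
            (next stay ++ []) ++ route stay ++ rest stay             ↭⟨ PermP.++⁺ʳ _ (vertices↭ inner) ⟩
            (route inner ++ next inner ++ rest inner) ++ route stay ++ rest stay
              ↭⟨ ↭-solve 4 (λ x y z t → (x ⊕ (y ⊕ z)) ⊕ t ⊜ x ⊕ (y ⊕ (z ⊕ t))) ↭-refl (route inner) (next inner) (rest inner) _ ⟩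
            route inner ++ next inner ++ rest inner ++ route stay ++ rest stay ∎
        ; colours↭ = colours↭ inner
        ; route-length = route-length inner
        ; next-length = next-length inner
        ; next⊆ = next⊆ inner
        ; connects = λ p → Path-mono (next⊆ stay) (connects inner p) }
        where open PermutationReasoning
      nonempty : ∀ (xs : List V) → length xs ≡ 1 → ∃[ x ] x ∈ xs
      nonempty (x ∷ _) _ = x , here refl
      u∈back = proj₂ (nonempty (next back) (next-length back))

-- Absorbing an arbitrary vertex

AllPairs-++⁻ : {X : Set} {R : X → X → Set} → ∀ xs {ys} → AllPairs R (xs ++ ys) →
               AllPairs R xs × All (λ x → All (R x) ys) xs × AllPairs R ys
AllPairs-++⁻ [] a = [] , [] , a
AllPairs-++⁻ (x ∷ xs) (a ∷ as) with p , q , r ← AllPairs-++⁻ xs as =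
  AllP.++⁻ˡ xs a ∷ p , AllP.++⁻ʳ xs a ∷ q , r

AllPairs-reverse : {X : Set} {R Q : X → X → Set} → (∀ {x y} → R x y → Q y x) → ∀ xs →
                   AllPairs R xs → AllPairs Q (reverse xs)
AllPairs-reverse flip [] [] = []
AllPairs-reverse {Q = Q} flip (x ∷ xs) (a ∷ as) = subst (AllPairs Q) (sym (unfold-reverse x xs))
  (snoc (reverse xs) (AllPairs-reverse flip xs as) (PermP.All-resp-↭ (↭-sym (PermP.↭-reverse xs)) (All.map flip a)))
  where
  snoc : ∀ ys → AllPairs Q ys → All (λ y → Q y x) ys → AllPairs Q (ys ++ [ x ])
  snoc [] [] [] = [] ∷ []
  snoc (y ∷ ys) (p ∷ ps) (q ∷ qs) = AllP.++⁺ p (q ∷ []) ∷ snoc ys ps qs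

module _ {V : Set} (M : V → V → Bool) where

  headOr : V → List V → V
  headOr y [] = y
  headOr y (v ∷ _) = v

  -- The target y is the first vertex of a path that has already been built, so the last arc ends
  -- there but y is not listed.
  data Trail : List Bool → List V → V → Set where
    []  : ∀ {y} → Trail [] [] y
    _∷_ : ∀ {b g u ps y} → Arc b M u (headOr y ps) → Trail g ps y → Trail (b ∷ g) (u ∷ ps) y

  -- The first vertex has to come from S: the preceding vertex of the path is joined to its
  -- candidates, and x is not known to be among them.
  record Absorption (g : List Bool) (S : List V) (x y : V) : Set where
    constructor absorption
    field
      first   : V
      others  : List V
      first∈  : first ∈ S
      trail   : Trail g (first ∷ others) y
      spans   : first ∷ others ↭ x ∷ S

  Absorption-resp-↭ : ∀ {g S S' x y} → S ↭ S' → Absorption g S x y → Absorption g S' x y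
  Absorption-resp-↭ {x = x} r (absorption a ps a∈ t s) =
    absorption a ps (PermP.∈-resp-↭ r a∈) t (↭-trans s (prep x r))

-- S is transitive in the direction e of the exit arc because one greedy selection yields both the
-- order on S and the common neighbours from which y comes. Nothing is assumed on the arcs at x.
Absorbing : List Bool → ℕ → Set₁
Absorbing g n = ∀ {V : Set} {M : V → V → Bool} → Semicomplete M → ∀ e S → length S ≡ n →
  AllPairs (Arc e M) S → ∀ {x y} → All (x ≢_) S → All (λ s → Arc e M s y) S →
  Absorption M (g ++ e ∷ []) S x y

-- The exit arcs force the direction in which S is built; reversing S decouples it from b.
Absorbing-from : ∀ b {g n} →
  (∀ {V : Set} {M : V → V → Bool} → Semicomplete M → ∀ e S → length S ≡ n →
    AllPairs (Arc b M) S → ∀ {x y} → All (x ≢_) S → All (λ s → Arc e M s y) S →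
    Absorption M (g ++ e ∷ []) S x y) → Absorbing g n
Absorbing-from b {g} f {M = M} sc e S l tr x∉ out with b Bool.≟ e
... | yes refl = f sc e S l tr x∉ out
... | no b≢e = Absorption-resp-↭ M (PermP.↭-reverse S) (f sc e (reverse S) (trans (length-reverse S) l)
    (AllPairs-reverse (flip b e b≢e) S tr)
    (PermP.All-resp-↭ (↭-sym (PermP.↭-reverse S)) x∉) (PermP.All-resp-↭ (↭-sym (PermP.↭-reverse S)) out))
  where
  flip : ∀ b e → b ≢ e → ∀ {u v} → Arc e M u v → Arc b M v u
  flip true true ne = ⊥-elim (ne refl)
  flip true false ne = λ a → a
  flip false true ne = λ a → a
  flip false false ne = ⊥-elim (ne refl)

module _ {V : Set} {M : V → V → Bool} (sc : Semicomplete M) (b : Bool) where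

  private
    _⇒_ : V → V → Set
    u ⇒ v = Arc b M u v

  -- Both ends appear as indices, since the turns at the ends of the block are attached to them.
  data Chain : V → List V → V → Set where
    []  : ∀ {u} → Chain u [] u
    _∷_ : ∀ {u v xs z} → u ⇒ v → Chain v xs z → Chain u (v ∷ xs) z

  chain-through : ∀ {u v} Z → u ⇒ v → All (u ⇒_) Z → AllPairs _⇒_ Z → All (_⇒ v) Z → Chain u (Z ++ [ v ]) v
  chain-through [] uv [] [] [] = uv ∷ []
  chain-through (z ∷ Z) uv (uz ∷ _) (zZ ∷ ZZ) (zv ∷ Zv) = uz ∷ chain-through Z zv zZ ZZ Zv

  chain-snoc : ∀ {u xs v x} → Chain u xs v → v ⇒ x → Chain u (xs ++ [ x ]) x
  chain-snoc [] vx = vx ∷ []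
  chain-snoc (r ∷ c) vx = r ∷ chain-snoc c vx

  -- Rédei's insertion argument
  chain-insert : ∀ {u v' xs z x} → Chain u (v' ∷ xs) z → u ⇒ x → x ⇒ z → All (x ≢_) (v' ∷ xs) →
                 ∃[ ys ] Chain u ys z × ys ↭ x ∷ v' ∷ xs
  chain-insert (r ∷ []) ux xz _ = _ , ux ∷ xz ∷ [] , ↭-refl
  chain-insert {v' = v'} {x = x} (r ∷ c@(_ ∷ _)) ux xz (ne ∷ nes) with Arc-total sc b ne
  ... | inj₁ xv = _ , ux ∷ xv ∷ c , ↭-refl
  ... | inj₂ vx with ys , c' , p ← chain-insert c vx xz nes =
    v' ∷ ys , r ∷ c' , ↭-trans (prep v' p) (swap v' x ↭-refl)

  chain-trail : ∀ {u xs z t e y} → Chain u xs z → t ⇒ z → Arc e M t y →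
                Trail M (replicate (length xs) b ++ not b ∷ e ∷ []) (u ∷ xs ++ [ t ]) y
  chain-trail [] tz ty = Arc-flip b tz ∷ ty ∷ []
  chain-trail (r ∷ c) tz ty = r ∷ chain-trail c tz ty

  -- The vertices a and t stand outside the block: its start dominates a and its end is dominated by
  -- t, which gives the two opposite arcs enclosing it.
  block-trail : ∀ {n u xs z a t e y} → Chain u xs z → length xs ≡ n → u ⇒ a → t ⇒ z → Arc e M t y →
                Trail M ((not b ∷ replicate n b ++ not b ∷ []) ++ e ∷ []) (a ∷ u ∷ xs ++ [ t ]) y
  block-trail {n = n} {u = u} {xs} {a = a} {t} {e} {y} c refl ua tz ty = subst (λ g → Trail M (not b ∷ g) (a ∷ u ∷ xs ++ [ t ]) y)
    (sym (++-assoc (replicate n b) (not b ∷ []) (e ∷ []))) (Arc-flip b ua ∷ chain-trail c tz ty)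

  zigzag-trail : ∀ {p₁ p₂ p₃ p₄ p₅ p₆ e y} → p₂ ⇒ p₁ → p₂ ⇒ p₃ → p₄ ⇒ p₃ → p₄ ⇒ p₅ → p₆ ⇒ p₅ → Arc e M p₆ y →
    Trail M (not b ∷ b ∷ not b ∷ b ∷ not b ∷ e ∷ []) (p₁ ∷ p₂ ∷ p₃ ∷ p₄ ∷ p₅ ∷ p₆ ∷ []) y
  zigzag-trail r₁ r₂ r₃ r₄ r₅ r₆ = Arc-flip b r₁ ∷ r₂ ∷ Arc-flip b r₃ ∷ r₄ ∷ Arc-flip b r₅ ∷ r₆ ∷ []

  module _ {s₁ s₂ s₃ s₄ : V} (Z : List V) {e : Bool} {x y : V} where

    private
      S : List V
      S = s₁ ∷ s₂ ∷ Z ++ s₃ ∷ s₄ ∷ []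

      -- A block with ℓ arcs has ℓ + 1 vertices; with one more beyond each end this makes |S| + 1,
      -- which is S together with x.
      ℓ : ℕ
      ℓ = suc (suc (length Z))

      s₁∈ : s₁ ∈ S
      s₁∈ = here refl
      s₂∈ : s₂ ∈ S
      s₂∈ = there (here refl)
      s₃∈ : s₃ ∈ S
      s₃∈ = there (there (∈-++⁺ʳ Z (here refl)))
      s₄∈ : s₄ ∈ S
      s₄∈ = there (there (∈-++⁺ʳ Z (there (here refl))))

      length-snoc : ∀ (xs : List V) {v} → length (xs ++ [ v ]) ≡ suc (length xs)
      length-snoc xs = trans (length-++ xs) (+-comm (length xs) 1)

    -- x is placed at the source or at the sink of the block if its two neighbours there
    -- allow it; otherwise some vertex early in the block dominates x and some late one is
    -- dominated by x, and x is inserted in between.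
    block-absorption : AllPairs _⇒_ S → All (x ≢_) S → All (λ s → Arc e M s y) S →
                       Absorption M ((not b ∷ replicate ℓ b ++ not b ∷ []) ++ e ∷ []) S x y
    block-absorption ((s₁₂ ∷ s₁a) ∷ s₂a ∷ tr) x∉@(x≢s₁ ∷ x≢s₂ ∷ x≢a) out
      with AllPairs-++⁻ Z tr | AllP.++⁻ Z s₁a | AllP.++⁻ Z s₂a | AllP.++⁻ Z x≢a
    ... | ZZ , Za , (s₃₄ ∷ []) ∷ _ | s₁Z , s₁₃ ∷ s₁₄ ∷ [] | s₂Z , s₂₃ ∷ s₂₄ ∷ [] | x≢Z , x≢s₃ ∷ x≢s₄ ∷ [] = choose
      where
      Zs₃ = All.map All.head Za
      Zs₄ = All.map (λ p → All.head (All.tail p)) Za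

      exit : ∀ {s} → s ∈ S → Arc e M s y
      exit = All.lookup out

      at-source : ∀ {a t} → a ∈ S → t ∈ S → a ∷ t ∷ [] ↭ s₂ ∷ s₃ ∷ [] → x ⇒ s₁ → x ⇒ a → t ⇒ s₄ →
                  Absorption M ((not b ∷ replicate ℓ b ++ not b ∷ []) ++ e ∷ []) S x y
      at-source {a} {t} a∈ t∈ r xs₁ xa ts₄ = absorption a _ a∈
        (block-trail (xs₁ ∷ chain-through Z s₁₄ s₁Z ZZ Zs₄) (cong suc (length-snoc Z)) xa ts₄ (exit t∈))
        (↭-trans (↭-solve 6 (λ a x s₁ Z s₄ t → a ⊕ (x ⊕ (s₁ ⊕ ((Z ⊕ s₄) ⊕ t))) ⊜ (x ⊕ (s₁ ⊕ (Z ⊕ s₄))) ⊕ (a ⊕ t)) ↭-refl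
            [ a ] [ x ] [ s₁ ] Z [ s₄ ] [ t ])
          (↭-trans (PermP.++⁺ˡ (x ∷ s₁ ∷ Z ++ [ s₄ ]) r)
            (↭-solve 6 (λ s₂ x s₁ Z s₄ s₃ → (x ⊕ (s₁ ⊕ (Z ⊕ s₄))) ⊕ (s₂ ⊕ s₃) ⊜ x ⊕ (s₁ ⊕ (s₂ ⊕ (Z ⊕ (s₃ ⊕ s₄))))) ↭-refl
              [ s₂ ] [ x ] [ s₁ ] Z [ s₄ ] [ s₃ ])))

      at-sink : ∀ {a t} → a ∈ S → t ∈ S → a ∷ t ∷ [] ↭ s₂ ∷ s₃ ∷ [] → s₄ ⇒ x → s₁ ⇒ a → t ⇒ x →
                Absorption M ((not b ∷ replicate ℓ b ++ not b ∷ []) ++ e ∷ []) S x y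
      at-sink {a} {t} a∈ t∈ r s₄x s₁a tx = absorption a _ a∈
        (block-trail (chain-snoc (chain-through Z s₁₄ s₁Z ZZ Zs₄) s₄x)
          (trans (length-snoc (Z ++ [ s₄ ])) (cong suc (length-snoc Z))) s₁a tx (exit t∈))
        (↭-trans (↭-solve 6 (λ a x s₁ Z s₄ t → a ⊕ (s₁ ⊕ (((Z ⊕ s₄) ⊕ x) ⊕ t)) ⊜ (x ⊕ (s₁ ⊕ (Z ⊕ s₄))) ⊕ (a ⊕ t)) ↭-refl
            [ a ] [ x ] [ s₁ ] Z [ s₄ ] [ t ])
          (↭-trans (PermP.++⁺ˡ (x ∷ s₁ ∷ Z ++ [ s₄ ]) r)
            (↭-solve 6 (λ s₂ x s₁ Z s₄ s₃ → (x ⊕ (s₁ ⊕ (Z ⊕ s₄))) ⊕ (s₂ ⊕ s₃) ⊜ x ⊕ (s₁ ⊕ (s₂ ⊕ (Z ⊕ (s₃ ⊕ s₄))))) ↭-refl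
              [ s₂ ] [ x ] [ s₁ ] Z [ s₄ ] [ s₃ ])))

      inside : ∀ {u z a t} → a ∈ S → t ∈ S → a ∷ u ∷ (Z ++ [ z ]) ++ [ t ] ↭ S →
               Chain u (Z ++ [ z ]) z → x ≢ z → u ⇒ x → x ⇒ z → u ⇒ a → t ⇒ z →
               Absorption M ((not b ∷ replicate ℓ b ++ not b ∷ []) ++ e ∷ []) S x y
      inside {u} {z} {a} {t} a∈ t∈ r c x≢z ux xz ua tz with nonempty-insert c (AllP.++⁺ x≢Z (x≢z ∷ []))
        where
        nonempty-insert : ∀ {xs} → Chain u xs z → All (x ≢_) xs → 1 ≤ length xs → ∃[ ys ] Chain u ys z × ys ↭ x ∷ xs
        nonempty-insert {xs = _ ∷ _} c nes _ = chain-insert c ux xz nes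
      ... | ins with ys , c' , p ← ins (subst (1 ≤_) (sym (length-snoc Z)) (s≤s z≤n)) = absorption a _ a∈
        (block-trail c' (trans (PermP.↭-length p) (cong suc (length-snoc Z))) ua tz (exit t∈))
        (↭-trans (prep a (prep u (PermP.++⁺ʳ [ t ] p)))
          (↭-trans (↭-solve 5 (λ a u x Z t → a ⊕ (u ⊕ ((x ⊕ Z) ⊕ t)) ⊜ x ⊕ (a ⊕ (u ⊕ (Z ⊕ t)))) ↭-refl [ a ] [ u ] [ x ] (Z ++ [ z ]) [ t ])
            (prep x r)))

      -- The source needs x to dominate s₁ and one of s₂, s₃; the sink needs s₄ and one of s₂, s₃ to
      -- dominate x. The spare one of s₂, s₃ serves at the other end.
      choose : Absorption M ((not b ∷ replicate ℓ b ++ not b ∷ []) ++ e ∷ []) S x y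
      choose with Arc-total sc b x≢s₁ | Arc-total sc b x≢s₂ | Arc-total sc b x≢s₃ | Arc-total sc b x≢s₄
      ... | inj₁ o₁ | inj₁ o₂ | _ | _ = at-source s₂∈ s₃∈ ↭-refl o₁ o₂ s₃₄
      ... | inj₁ o₁ | inj₂ i₂ | inj₁ o₃ | _ = at-source s₃∈ s₂∈ (swap s₃ s₂ ↭-refl) o₁ o₃ s₂₄
      ... | inj₁ o₁ | inj₂ i₂ | inj₂ i₃ | inj₂ i₄ = at-sink s₂∈ s₃∈ ↭-refl i₄ s₁₂ i₃
      ... | inj₁ o₁ | inj₂ i₂ | inj₂ i₃ | inj₁ o₄ = inside s₃∈ s₁∈
        (↭-solve 5 (λ s₁ s₂ Z s₃ s₄ → s₃ ⊕ (s₂ ⊕ ((Z ⊕ s₄) ⊕ s₁)) ⊜ s₁ ⊕ (s₂ ⊕ (Z ⊕ (s₃ ⊕ s₄)))) ↭-refl [ s₁ ] [ s₂ ] Z [ s₃ ] [ s₄ ])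
        (chain-through Z s₂₄ s₂Z ZZ Zs₄) x≢s₄ i₂ o₄ s₂₃ s₁₄
      ... | inj₂ i₁ | _ | _ | inj₁ o₄ = inside s₂∈ s₃∈
        (↭-solve 5 (λ s₁ s₂ Z s₃ s₄ → s₂ ⊕ (s₁ ⊕ ((Z ⊕ s₄) ⊕ s₃)) ⊜ s₁ ⊕ (s₂ ⊕ (Z ⊕ (s₃ ⊕ s₄)))) ↭-refl [ s₁ ] [ s₂ ] Z [ s₃ ] [ s₄ ])
        (chain-through Z s₁₄ s₁Z ZZ Zs₄) x≢s₄ i₁ o₄ s₁₂ s₃₄
      ... | inj₂ i₁ | _ | inj₂ i₃ | inj₂ i₄ = at-sink s₂∈ s₃∈ ↭-refl i₄ s₁₂ i₃
      ... | inj₂ i₁ | inj₂ i₂ | inj₁ o₃ | inj₂ i₄ = at-sink s₃∈ s₂∈ (swap s₃ s₂ ↭-refl) i₄ s₁₃ i₂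
      ... | inj₂ i₁ | inj₁ o₂ | inj₁ o₃ | inj₂ i₄ = inside s₄∈ s₂∈
        (↭-solve 5 (λ s₁ s₂ Z s₃ s₄ → s₄ ⊕ (s₁ ⊕ ((Z ⊕ s₃) ⊕ s₂)) ⊜ s₁ ⊕ (s₂ ⊕ (Z ⊕ (s₃ ⊕ s₄)))) ↭-refl [ s₁ ] [ s₂ ] Z [ s₃ ] [ s₄ ])
        (chain-through Z s₁₃ s₁Z ZZ Zs₃) x≢s₃ i₁ o₃ s₁₄ s₂₃

  -- Inner vertices of an alternating path are joined alike to both neighbours, so x fits between
  -- two vertices joined alike to it. Such a pair is found among s₁, s₂, s₃ if x dominates s₃ and
  -- among s₃, s₄, s₅ otherwise; the order of S completes the pattern.
  zigzag-absorption : ∀ {s₁ s₂ s₃ s₄ s₅ e x y} → let S = s₁ ∷ s₂ ∷ s₃ ∷ s₄ ∷ s₅ ∷ [] in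
    AllPairs _⇒_ S → All (x ≢_) S → All (λ s → Arc e M s y) S →
    Absorption M (not b ∷ b ∷ not b ∷ b ∷ not b ∷ e ∷ []) S x y
  zigzag-absorption {s₁} {s₂} {s₃} {s₄} {s₅} {e} {x} {y}
    ((s₁₂ ∷ s₁₃ ∷ s₁₄ ∷ s₁₅ ∷ []) ∷ (s₂₃ ∷ s₂₄ ∷ s₂₅ ∷ []) ∷ (s₃₄ ∷ s₃₅ ∷ []) ∷ (s₄₅ ∷ []) ∷ _)
    (n₁ ∷ n₂ ∷ n₃ ∷ n₄ ∷ n₅ ∷ []) out = choose
    where
    S = s₁ ∷ s₂ ∷ s₃ ∷ s₄ ∷ s₅ ∷ []

    at-source : ∀ {a c i j h} → x ⇒ a → x ⇒ c → i ⇒ c → i ⇒ h → j ⇒ h → a ∷ c ∷ i ∷ h ∷ j ∷ [] ↭ S →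
                Absorption M (not b ∷ b ∷ not b ∷ b ∷ not b ∷ e ∷ []) S x y
    at-source {a} {c} {i} {j} {h} xa xc ic ih jh r = absorption a (x ∷ c ∷ i ∷ h ∷ j ∷ []) (PermP.∈-resp-↭ r (here refl))
      (zigzag-trail xa xc ic ih jh (All.lookup out (PermP.∈-resp-↭ r (there (there (there (there (here refl))))))))
      (↭-trans (swap a x ↭-refl) (prep x r))

    at-sink : ∀ {a c d f i} → d ⇒ x → f ⇒ x → d ⇒ c → i ⇒ c → i ⇒ a → a ∷ i ∷ c ∷ d ∷ f ∷ [] ↭ S →
              Absorption M (not b ∷ b ∷ not b ∷ b ∷ not b ∷ e ∷ []) S x y
    at-sink {a} {c} {d} {f} {i} dx fx dc ic ia r = absorption a (i ∷ c ∷ d ∷ x ∷ f ∷ []) (PermP.∈-resp-↭ r (here refl))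
      (zigzag-trail ia ic dc dx fx (All.lookup out (PermP.∈-resp-↭ r (there (there (there (there (here refl))))))))
      (↭-trans (PermP.shift x (a ∷ i ∷ c ∷ d ∷ []) [ f ]) (prep x r))

    choose : Absorption M (not b ∷ b ∷ not b ∷ b ∷ not b ∷ e ∷ []) S x y
    choose with Arc-total sc b n₁ | Arc-total sc b n₂ | Arc-total sc b n₃ | Arc-total sc b n₄ | Arc-total sc b n₅
    ... | inj₁ o₁ | _ | inj₁ o₃ | _ | _ = at-source {s₁} {s₃} {s₂} {s₄} {s₅} o₁ o₃ s₂₃ s₂₅ s₄₅
      (↭-solve 5 (λ s₁ s₂ s₃ s₄ s₅ → s₁ ⊕ (s₃ ⊕ (s₂ ⊕ (s₅ ⊕ s₄))) ⊜ s₁ ⊕ (s₂ ⊕ (s₃ ⊕ (s₄ ⊕ s₅)))) ↭-refl [ s₁ ] [ s₂ ] [ s₃ ] [ s₄ ] [ s₅ ])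
    ... | inj₂ i₁ | inj₁ o₂ | inj₁ o₃ | _ | _ = at-source {s₂} {s₃} {s₁} {s₄} {s₅} o₂ o₃ s₁₃ s₁₅ s₄₅
      (↭-solve 5 (λ s₁ s₂ s₃ s₄ s₅ → s₂ ⊕ (s₃ ⊕ (s₁ ⊕ (s₅ ⊕ s₄))) ⊜ s₁ ⊕ (s₂ ⊕ (s₃ ⊕ (s₄ ⊕ s₅)))) ↭-refl [ s₁ ] [ s₂ ] [ s₃ ] [ s₄ ] [ s₅ ])
    ... | inj₂ i₁ | inj₂ i₂ | inj₁ o₃ | _ | _ = at-sink {s₅} {s₄} {s₁} {s₂} {s₃} i₁ i₂ s₁₄ s₃₄ s₃₅
      (↭-solve 5 (λ s₁ s₂ s₃ s₄ s₅ → s₅ ⊕ (s₃ ⊕ (s₄ ⊕ (s₁ ⊕ s₂))) ⊜ s₁ ⊕ (s₂ ⊕ (s₃ ⊕ (s₄ ⊕ s₅)))) ↭-refl [ s₁ ] [ s₂ ] [ s₃ ] [ s₄ ] [ s₅ ])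
    ... | _ | _ | inj₂ i₃ | inj₁ o₄ | inj₁ o₅ = at-source {s₄} {s₅} {s₁} {s₂} {s₃} o₄ o₅ s₁₅ s₁₃ s₂₃
      (↭-solve 5 (λ s₁ s₂ s₃ s₄ s₅ → s₄ ⊕ (s₅ ⊕ (s₁ ⊕ (s₃ ⊕ s₂))) ⊜ s₁ ⊕ (s₂ ⊕ (s₃ ⊕ (s₄ ⊕ s₅)))) ↭-refl [ s₁ ] [ s₂ ] [ s₃ ] [ s₄ ] [ s₅ ])
    ... | _ | _ | inj₂ i₃ | inj₂ i₄ | _ = at-sink {s₂} {s₅} {s₃} {s₄} {s₁} i₃ i₄ s₃₅ s₁₅ s₁₂
      (↭-solve 5 (λ s₁ s₂ s₃ s₄ s₅ → s₂ ⊕ (s₁ ⊕ (s₅ ⊕ (s₃ ⊕ s₄))) ⊜ s₁ ⊕ (s₂ ⊕ (s₃ ⊕ (s₄ ⊕ s₅)))) ↭-refl [ s₁ ] [ s₂ ] [ s₃ ] [ s₄ ] [ s₅ ])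
    ... | _ | _ | inj₂ i₃ | inj₁ _ | inj₂ i₅ = at-sink {s₂} {s₄} {s₃} {s₅} {s₁} i₃ i₅ s₃₄ s₁₄ s₁₂
      (↭-solve 5 (λ s₁ s₂ s₃ s₄ s₅ → s₂ ⊕ (s₁ ⊕ (s₄ ⊕ (s₃ ⊕ s₅))) ⊜ s₁ ⊕ (s₂ ⊕ (s₃ ⊕ (s₄ ⊕ s₅)))) ↭-refl [ s₁ ] [ s₂ ] [ s₃ ] [ s₄ ] [ s₅ ])

block-absorbing : ∀ b j → Absorbing (not b ∷ replicate (suc (suc j)) b ++ not b ∷ []) (4 + j)
block-absorbing b j = Absorbing-from b {g = not b ∷ replicate (suc (suc j)) b ++ not b ∷ []} body
  where
  body : ∀ {V : Set} {M : V → V → Bool} → Semicomplete M → ∀ e S → length S ≡ 4 + j →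
    AllPairs (Arc b M) S → ∀ {x y} → All (x ≢_) S → All (λ s → Arc e M s y) S →
    Absorption M ((not b ∷ replicate (suc (suc j)) b ++ not b ∷ []) ++ e ∷ []) S x y
  body sc e (s₁ ∷ s₂ ∷ S) l tr x∉ out
    with trim j S (≤-trans (m≤n+m j 2) (≤-reflexive (sym (suc-injective (suc-injective l)))))
  ... | Z , Y , refl , lZ with Y | +-cancelˡ-≡ j (length Y) 2 (trans (cong (_+ length Y) (sym lZ))
      (trans (sym (length-++ Z)) (trans (suc-injective (suc-injective l)) (+-comm 2 j))))
  ... | s₃ ∷ s₄ ∷ [] | _ = subst (λ i → Absorption _ ((not b ∷ replicate (suc (suc i)) b ++ not b ∷ []) ++ e ∷ []) _ _ _) lZ
    (block-absorption sc b Z tr x∉ out)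

zigzag-absorbing : ∀ b → Absorbing (not b ∷ b ∷ not b ∷ b ∷ not b ∷ []) 5
zigzag-absorbing b = Absorbing-from b {g = not b ∷ b ∷ not b ∷ b ∷ not b ∷ []} body
  where
  body : ∀ {V : Set} {M : V → V → Bool} → Semicomplete M → ∀ e S → length S ≡ 5 →
    AllPairs (Arc b M) S → ∀ {x y} → All (x ≢_) S → All (λ s → Arc e M s y) S →
    Absorption M (not b ∷ b ∷ not b ∷ b ∷ not b ∷ e ∷ []) S x y
  body sc e (_ ∷ _ ∷ _ ∷ _ ∷ _ ∷ []) l tr x∉ out = zigzag-absorption sc b tr x∉ out

-- Orientation words

-- Shortness of the blocks, in a form that passes to every factor of a word.
Mixed : ℕ → List Bool → Set
Mixed k w = ∀ pre mid post → w ≡ pre ++ mid ++ post → k ≤ length mid → ∀ b → b ∈ mid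

Mixed-++ʳ : ∀ {k} u {w} → Mixed k (u ++ w) → Mixed k w
Mixed-++ʳ u {w} mx pre mid post refl = mx (u ++ pre) mid post (sym (++-assoc u pre (mid ++ post)))

Mixed-++ˡ : ∀ {k} u {w} → Mixed k (u ++ w) → Mixed k u
Mixed-++ˡ u {w} mx pre mid post refl = mx pre mid (post ++ w)
  (trans (++-assoc pre (mid ++ post) w) (cong (pre ++_) (++-assoc mid post w)))

first-occurrence : ∀ b {w} → b ∈ w → ∃[ i ] ∃[ w' ] w ≡ replicate i (not b) ++ b ∷ w' × i < length w
first-occurrence true {true ∷ w} _ = 0 , w , refl , s≤s z≤n
first-occurrence false {false ∷ w} _ = 0 , w , refl , s≤s z≤n
first-occurrence true {false ∷ w} (there b∈) with i , w' , refl , i< ← first-occurrence true b∈ = suc i , w' , refl , s≤s i<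
first-occurrence false {true ∷ w} (there b∈) with i , w' , refl , i< ← first-occurrence false b∈ = suc i , w' , refl , s≤s i<

-- The first k letters contain b, so one search uses up at most k letters.
next-letter : ∀ {k w} b r → Mixed k w → k + r ≤ length w →
              ∃[ i ] ∃[ w' ] w ≡ replicate i (not b) ++ b ∷ w' × Mixed k w' × r ≤ length w'
next-letter {k} {w} b r mx l
  with mid , post , refl , lm ← trim k w (≤-trans (m≤m+n k r) l)
  with i , w' , refl , i< ← first-occurrence b (mx [] mid post refl (≤-reflexive (sym lm)) b) =
  i , w' ++ post , e , Mixed-++ʳ (replicate i (not b) ++ [ b ]) (subst (Mixed k) (trans e (sym (++-assoc (replicate i (not b)) [ b ] _))) mx) ,
  ≤-trans (+-cancelˡ-≤ k r (length post) (≤-trans l (≤-reflexive (trans (length-++ (replicate i (not b) ++ b ∷ w')) (cong (_+ length post) lm)))))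
    (≤-trans (m≤n+m _ (length w')) (≤-reflexive (sym (length-++ w'))))
  where
  e = ++-assoc (replicate i (not b)) (b ∷ w') post

-- The letter e is the arc leaving the gadget. It is kept apart from g because its direction
-- determines how S is selected.
record Gadget (w : List Bool) : Set₁ where
  field
    pre g post : List Bool
    e : Bool
    factorises : w ≡ pre ++ g ++ e ∷ post
    absorbing : Absorbing g (length g)

Gadget-++ : ∀ u {w} → Gadget w → Gadget (u ++ w)
Gadget-++ u {w} G = record
  { pre = u ++ pre ; g = g ; post = post ; e = e
  ; factorises = trans (cong (u ++_) factorises) (sym (++-assoc u pre _))
  ; absorbing = absorbing }
  where open Gadget G

block-gadget : ∀ b j w → 1 ≤ length w → Gadget (not b ∷ replicate (suc (suc j)) b ++ not b ∷ w)
block-gadget b j (e ∷ w) _ = record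
  { pre = [] ; g = not b ∷ replicate (suc (suc j)) b ++ not b ∷ [] ; post = w ; e = e
  ; factorises = sym (++-assoc (not b ∷ replicate (suc (suc j)) b) (not b ∷ []) (e ∷ w))
  ; absorbing = subst (Absorbing (not b ∷ replicate (suc (suc j)) b ++ not b ∷ [])) len (block-absorbing b j) }
  where
  len : 4 + j ≡ length (not b ∷ replicate (suc (suc j)) b ++ not b ∷ [])
  len = cong (3 +_) (sym (trans (length-++ (replicate j b)) (trans (+-comm _ 1) (cong suc (length-replicate j)))))

zigzag-gadget : ∀ b w → 1 ≤ length w → Gadget (not b ∷ b ∷ not b ∷ b ∷ not b ∷ w)
zigzag-gadget b (e ∷ w) _ = record
  { pre = [] ; g = not b ∷ b ∷ not b ∷ b ∷ not b ∷ [] ; post = w ; e = e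
  ; factorises = refl
  ; absorbing = zigzag-absorbing b }

-- Of three consecutive blocks, one has length at least 2 or all have length 1.
find-gadget : ∀ {k} w → Mixed k w → 1 ≤ k → length w ≡ 6 * k → Gadget w
-- At most five searches are made, each costing at most k letters; the last k letters guarantee one
-- for the exit arc.
find-gadget {k} w mx 1≤k l with next-letter false (5 * k) mx (≤-reflexive (sym l))
... | i , w₁ , refl , mx₁ , l₁ with next-letter true (4 * k) mx₁ l₁
-- The last `false` of the run is moved next to the `true` that follows, so that the search for a
-- block starts at a turn.
... | j , w₂ , refl , mx₂ , l₂ = subst Gadget (trans (++-assoc (replicate i true) (replicate j false) _)
      (cong (replicate i true ++_) (replicate-shift j false (true ∷ w₂))))
      (Gadget-++ (replicate i true ++ replicate j false) (from-turn w₂ mx₂ l₂))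
  where
  replicate-shift : ∀ {X : Set} n (x : X) xs → replicate n x ++ x ∷ xs ≡ x ∷ replicate n x ++ xs
  replicate-shift zero x xs = refl
  replicate-shift (suc n) x xs = cong (x ∷_) (replicate-shift n x xs)
  k≥1 : ∀ {n} → 1 * k ≤ n → 1 ≤ n
  k≥1 = ≤-trans (≤-trans 1≤k (≤-reflexive (sym (*-identityˡ k))))
  weaken : ∀ {n} m → suc m * k ≤ n → 1 * k ≤ n
  weaken m = ≤-trans (*-monoˡ-≤ k {1} {suc m} (s≤s z≤n))
  from-turn : ∀ w → Mixed k w → 4 * k ≤ length w → Gadget (false ∷ true ∷ w)
  from-turn w mx l with next-letter false (3 * k) mx l
  ... | suc i , w₁ , refl , mx₁ , l₁ = block-gadget true i w₁ (k≥1 (weaken 2 l₁))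
  ... | zero , w₁ , refl , mx₁ , l₁ with next-letter true (2 * k) mx₁ l₁
  ... | suc i , w₂ , refl , mx₂ , l₂ = Gadget-++ [ false ] (block-gadget false i w₂ (k≥1 (weaken 1 l₂)))
  ... | zero , w₂ , refl , mx₂ , l₂ with next-letter false (1 * k) mx₂ l₂
  ... | suc i , w₃ , refl , mx₃ , l₃ = Gadget-++ (false ∷ true ∷ []) (block-gadget true i w₃ (k≥1 l₃))
  ... | zero , w₃ , refl , mx₃ , l₃ = zigzag-gadget true w₃ (k≥1 l₃)

-- Majority digraphs

-- Each selected vertex restricts the list to its out-neighbours, so it dominates all later
-- selections and also the q vertices that remain.
transitive-list : ∀ {V : Set} {R : V → V → Bool} → Semicomplete R → ∀ j q N → Unique N → 1 ≤ q → 2 ^ j * q ≤ length N →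
  ∃[ S ] ∃[ N' ] ∃[ I ] N ↭ S ++ N' ++ I × length S ≡ j × length N' ≡ q ×
    AllPairs (λ u v → R u v ≡ true) S × All (λ s → All (λ v → R s v ≡ true) N') S
transitive-list sc zero q N N! 1≤q l with N' , I , refl , lN ← trim q N (≤-trans (≤-reflexive (sym (+-identityʳ q))) l) =
  [] , N' , I , ↭-refl , refl , lN , [] , []
transitive-list sc (suc j) q N N! 1≤q l
  with u , O , I , r , lO , a ← large-outdegree sc (2 ^ j * q) N N! (*-mono-≤ (m^n>0 2 j) 1≤q)
         (≤-trans (≤-reflexive (sym (*-assoc 2 (2 ^ j) q))) l)
  with S , N' , I' , r' , lS , lN , tr , out ← transitive-list sc j q O (unique-++ˡ O (unique-++ʳ [ u ] (unique-resp-↭ r N!))) 1≤q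
         (≤-reflexive (sym lO))
  with aS , aN ← AllP.++⁻ S (PermP.All-resp-↭ r' a) =
  u ∷ S , N' , I' ++ I ,
  ↭-trans r (prep u (↭-trans (PermP.++⁺ʳ I r') (↭-solve 4 (λ x y z t → (x ⊕ (y ⊕ z)) ⊕ t ⊜ x ⊕ (y ⊕ (z ⊕ t))) ↭-refl S N' I' I))) ,
  cong suc lS , lN , aS ∷ tr , AllP.++⁻ˡ N' aN ∷ out

module Majority {V C : Set} (T : C → V → V → Bool) (TS : ∀ c → Semicomplete (T c)) (End : V → Set) (K : ℕ) (D : List C) where
  open Rainbow T TS End

  -- An arc present in more than K colours of D still has a free colour after any K colours of D
  -- have been spent; 2K + 1 colours make one direction of each pair such an arc.
  majority : V → V → Bool
  majority u v = K <ᵇ count (λ d → T d u v) D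

  majority-semicomplete : suc (2 * K) ≤ length D → Semicomplete majority
  majority-semicomplete D≥ = record
    { irreflexive = λ u → cong (K <ᵇ_) (count-zero (λ d → T d u u) D (λ d → irreflexive (TS d) u))
    ; total = tot }
    where
    tot : ∀ {u v} → u ≢ v → majority u v ≡ true ⊎ majority v u ≡ true
    tot {u} {v} u≢v with K <? count (λ d → T d u v) D
    ... | yes K< = inj₁ (Equivalence.to T-≡ (<⇒<ᵇ K<))
    ... | no K≮ = inj₂ (Equivalence.to T-≡ (<⇒<ᵇ (+-cancelˡ-≤ K _ _ (≤-trans
        (≤-trans (≤-reflexive (trans (+-suc K K) (cong (λ z → suc (K + z)) (sym (+-identityʳ K))))) D≥)
        (≤-trans (length≤count+count (λ d → T d u v) (λ d → T d v u) D (All.tabulate λ {d} _ → total (TS d) u≢v))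
          (+-monoˡ-≤ _ (≮⇒≥ K≮)))))))

  majority-count : ∀ b {u v} → Arc b majority u v → K < count (λ d → dir b (T d) u v) D
  majority-count true {u} {v} a = <ᵇ⇒< K _ (Equivalence.from T-≡ a)
  majority-count false {u} {v} a = <ᵇ⇒< K _ (Equivalence.from T-≡ a)

  -- Greedy colouring: at most K colours of D are used before any arc of the trail, so one of its
  -- more than K colours is available.
  colour-trail : ∀ {g ps y} → Trail majority g ps y → ∀ used avail → D ↭ used ++ avail →
    length used + length g ≤ suc K →
    ∃[ cs ] ∃[ left ] avail ↭ cs ++ left × Connects [ headOr majority y ps ] g cs ps [ y ]
  colour-trail [] used avail r l = [] , avail , ↭-refl , λ p → p
  colour-trail {b ∷ g} {u ∷ ps} {y} (a ∷ t) used avail r l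
    with c , c∈ , ca ← count-pos (λ d → dir b (T d) u (headOr majority y ps)) avail
           (+-cancelˡ-≤ K 1 _ (≤-trans (≤-reflexive (+-comm K 1)) (≤-trans (majority-count b a)
             (≤-trans (≤-reflexive (trans (count-resp-↭ _ r) (count-++ _ used avail)))
               (+-monoˡ-≤ _ (≤-trans (count≤length _ used) (≤-pred (≤-trans (m≤m+n _ (length g))
                 (≤-trans (≤-reflexive (sym (+-suc (length used) (length g)))) l)))))))))
    with avail' , r₁ ← ↭-pick c∈
    with cs , left , r₂ , conn ← colour-trail t (c ∷ used) avail'
           (↭-trans r (↭-trans (PermP.++⁺ˡ used r₁) (PermP.shift c used avail')))
           (≤-trans (≤-reflexive (sym (+-suc (length used) (length g)))) l) =
    c ∷ cs , left , ↭-trans r₁ (prep c r₂) , λ p → step (here refl) (ca ∷ []) (conn p)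

-- Completing a path

-- Linear arithmetic in one step: both sides are brought to a known inequality by ring identities,
-- and c is cancelled.
≤-via : ∀ c {x y l r} → x + c ≡ l → l ≤ r → r ≡ y + c → x ≤ y
≤-via c {x} {y} e l≤r e' = +-cancelʳ-≤ c x y (≤-trans (≤-reflexive e) (≤-trans l≤r (≤-reflexive e')))

-- Q is the number of candidates kept between stages, β the number of reserved final
-- vertices, and a₀ the number of free vertices that suffices for a jump.
record Sizes (k : ℕ) : Set where
  field
    Q β a₀ : ℕ
    Q≥1    : 1 ≤ Q
    Q≥     : ∀ j → j ≤ 2 * k → 2 ^ j * 2 ^ j ≤ Q
    β≥     : ∀ j → j ≤ 2 * k → 2 * (2 ^ j * 1) ≤ β
    -- The exponent j pays for the halvings after a jump: before a vertex gadget these are the walk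
    -- to it and the selection of S, at most 6k together.
    a₀≥    : ∀ j → j ≤ 6 * k → 2 * (2 ^ k * (2 ^ j * Q)) ≤ a₀

module Stages {V C : Set} (T : C → V → V → Bool) (TS : ∀ c → Semicomplete (T c)) (End : V → Set)
              (k : ℕ) (1≤k : 1 ≤ k) (sizes : Sizes k) where
  open Rainbow T TS End
  open Sizes sizes

  -- A path from N together with the vertices W of X and the colours E of Cs that it misses.
  record Completion (N X : List V) (w : List Bool) (Cs : List C) : Set where
    constructor completion
    field
      vs : List V
      cs : List C
      W  : List V
      E  : List C
      path      : Path N w cs vs
      vertices↭ : vs ++ W ↭ X
      colours↭  : cs ++ E ↭ Cs

  leftover-vertices : ∀ {N X w Cs} (c : Completion N X w Cs) → suc (length w) + length (Completion.W c) ≡ length X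
  leftover-vertices (completion vs cs W E p r _) =
    trans (cong (_+ length W) (sym (proj₁ (Path-length p)))) (trans (sym (length-++ vs)) (PermP.↭-length r))

  leftover-colours : ∀ {N X w Cs} (c : Completion N X w Cs) → length w + length (Completion.E c) ≡ length Cs
  leftover-colours (completion vs cs W E p _ r) =
    trans (cong (_+ length E) (sym (proj₂ (Path-length p)))) (trans (sym (length-++ cs)) (PermP.↭-length r))

  Completion-cast : ∀ {N X w w' Cs Cs'} → w ≡ w' → Cs ↭ Cs' → Completion N X w Cs → Completion N X w' Cs'
  Completion-cast refl r (completion vs cs W E p v c) = completion vs cs W E p v (↭-trans c r)

  -- The reserved final vertices B are carried along untouched.
  advance-then : ∀ {N A Z w₁ cs₁ q w₂ cs₂ B} (a : Advance N A Z w₁ cs₁ q) →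
    Completion (next a) (next a ++ rest a ++ B) w₂ cs₂ → Completion N (N ++ A ++ B) (w₁ ++ w₂) (cs₁ ++ cs₂)
  advance-then {N} {A} {cs₁ = cs₁} {cs₂ = cs₂} {B} a (completion vs cs W E p v c) = completion
    (route a ++ vs) (colours a ++ cs) W E (connects a p)
    (begin
      (route a ++ vs) ++ W             ↭⟨ PermP.++-assoc (route a) vs W ⟩
      route a ++ (vs ++ W)             ↭⟨ PermP.++⁺ˡ (route a) v ⟩
      route a ++ (next a ++ rest a ++ B)
        ↭⟨ ↭-solve 4 (λ x y z t → x ⊕ (y ⊕ (z ⊕ t)) ⊜ (x ⊕ (y ⊕ z)) ⊕ t) ↭-refl (route a) (next a) (rest a) B ⟩
      (route a ++ next a ++ rest a) ++ B  ↭⟨ PermP.++⁺ʳ B (Rainbow.vertices↭ a) ⟨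
      (N ++ A) ++ B                    ↭⟨ PermP.++-assoc N A B ⟩
      N ++ A ++ B                      ∎)
    (begin
      (colours a ++ cs) ++ E           ↭⟨ PermP.++-assoc (colours a) cs E ⟩
      colours a ++ (cs ++ E)           ↭⟨ PermP.++⁺ (Rainbow.colours↭ a) c ⟩
      cs₁ ++ cs₂                       ∎)
    where open PermutationReasoning

  advance-length : ∀ {N A Z w cs q} (a : Advance N A Z w cs q) →
    length N + length A ≡ length w + (q + length (rest a))
  advance-length {N} {A} {w = w} {q = q} a = begin
    length N + length A                                     ≡⟨ length-++ N ⟨
    length (N ++ A)                                         ≡⟨ PermP.↭-length (Rainbow.vertices↭ a) ⟩
    length (route a ++ next a ++ rest a)                    ≡⟨ length-++ (route a) ⟩
    length (route a) + length (next a ++ rest a)            ≡⟨ cong₂ _+_ (route-length a) (length-++ (next a)) ⟩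
    length w + (length (next a) + length (rest a))          ≡⟨ cong (λ z → length w + (z + length (rest a))) (next-length a) ⟩
    length w + (q + length (rest a))                        ∎
    where open ≡-Reasoning

  advance-unique : ∀ {N A Z w cs q} B (a : Advance N A Z w cs q) → Unique (N ++ A ++ B) → Unique (next a ++ rest a ++ B)
  advance-unique {N} {A} B a U! = unique-++ʳ (route a) (unique-resp-↭ (begin
      N ++ A ++ B                         ↭⟨ PermP.++-assoc N A B ⟨
      (N ++ A) ++ B                       ↭⟨ PermP.++⁺ʳ B (Rainbow.vertices↭ a) ⟩
      (route a ++ next a ++ rest a) ++ B
        ↭⟨ ↭-solve 4 (λ x y z t → (x ⊕ (y ⊕ z)) ⊕ t ⊜ x ⊕ (y ⊕ (z ⊕ t))) ↭-refl (route a) (next a) (rest a) B ⟩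
      route a ++ next a ++ rest a ++ B    ∎) U!)
    where open PermutationReasoning

  unique-init : ∀ N A {B : List V} → Unique (N ++ A ++ B) → Unique (N ++ A)
  unique-init N A U! = unique-++ˡ (N ++ A) (subst Unique (sym (++-assoc N A _)) U!)

  unique-outer : ∀ N A {B : List V} → Unique (N ++ A ++ B) → Unique (N ++ B)
  unique-outer N A {B} U! = unique-++ʳ A (unique-resp-↭ (↭-solve 3 (λ x y z → x ⊕ (y ⊕ z) ⊜ y ⊕ (x ⊕ z)) ↭-refl N A B) U!)

  k≤2k : k ≤ 2 * k
  k≤2k = m≤m+n k (k + 0)

  -- The factor 2 ^ j allows j further halvings before the list is back at its standard size Q.
  k-jump : ∀ w cs N A j → Mixed k w → length w ≡ k → length cs ≡ k → Unique (N ++ A) → length N ≡ Q →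
           j ≤ 6 * k → a₀ ≤ length A → Advance N A A w cs (2 ^ j * Q)
  k-jump w cs N A j mx refl lc U! lN j≤ A≥ = jump w cs N A (2 ^ j * Q)
    (mx [] w [] (sym (++-identityʳ w)) ≤-refl) lc U! (*-mono-≤ (m^n>0 2 j) Q≥1)
    (≤-trans (Q≥ (length w) k≤2k) (≤-reflexive (sym lN))) (≤-trans (a₀≥ j j≤) A≥)

  -- The last jump goes into B and keeps a single candidate, which is the last vertex and therefore
  -- satisfies `End`.
  final-stage : ∀ w Cs N A B → Mixed k w → k ≤ length w → length w ≤ 2 * k → length w ≤ length Cs →
    length N ≡ Q → β ≤ length B → All End B → Unique (N ++ A ++ B) → Completion N (N ++ A ++ B) w Cs
  final-stage w Cs N A B mx k≤ ≤2k C≥ lN B≥ ends U!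
    with cs , E , refl , lc ← trim (length w) Cs C≥
    with a ← jump w cs N B 1 (mx [] w [] (sym (++-identityʳ w)) k≤) lc (unique-outer N A U!) ≤-refl
               (≤-trans (Q≥ (length w) ≤2k) (≤-reflexive (sym lN))) (≤-trans (β≥ (length w) ≤2k) B≥)
    with next a in eq | next-length a
  ... | y ∷ [] | _ = completion (route a ++ [ y ]) (colours a) (rest a ++ A) E
    (subst₂ (λ x z → Path N x z (route a ++ [ y ])) (++-identityʳ w) (++-identityʳ (colours a))
      (connects a (end y∈ (All.lookup ends (next⊆ a y∈)))))
    (begin
      (route a ++ [ y ]) ++ rest a ++ A   ↭⟨ ↭-solve 4 (λ x y z t → (x ⊕ y) ⊕ (z ⊕ t) ⊜ t ⊕ (x ⊕ (y ⊕ z))) ↭-refl (route a) [ y ] (rest a) A ⟩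
      A ++ (route a ++ [ y ] ++ rest a)   ↭⟨ PermP.++⁺ˡ A (subst (λ z → N ++ B ↭ route a ++ z ++ rest a) eq (Rainbow.vertices↭ a)) ⟨
      A ++ (N ++ B)                       ↭⟨ ↭-solve 3 (λ x y z → y ⊕ (x ⊕ z) ⊜ x ⊕ (y ⊕ z)) ↭-refl N A B ⟩
      N ++ A ++ B                         ∎)
    (PermP.++⁺ʳ E (Rainbow.colours↭ a))
    where
    open PermutationReasoning
    y∈ : y ∈ next a
    y∈ = subst (y ∈_) (sym eq) (here refl)

  -- Jumps use up k letters at a time until fewer than 2k remain; at least k are then left, so both
  -- orientations occur and the final jump is possible. The bound n makes the recursion structural.
  rest-stage : ∀ n w Cs N A B → length w ≤ n → Mixed k w → k ≤ length w → length w ≤ length Cs →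
    length N ≡ Q → length w + a₀ ≤ length A → β ≤ length B → All End B → Unique (N ++ A ++ B) →
    Completion N (N ++ A ++ B) w Cs
  rest-stage n w Cs N A B n≥ mx k≤ C≥ lN A≥ B≥ ends U! with 2 * k ≤? length w
  rest-stage n w Cs N A B n≥ mx k≤ C≥ lN A≥ B≥ ends U! | no ¬2k = final-stage w Cs N A B mx k≤ (<⇒≤ (≰⇒> ¬2k)) C≥ lN B≥ ends U!
  rest-stage zero w Cs N A B n≥ mx k≤ C≥ lN A≥ B≥ ends U! | yes _ = ⊥-elim (<-irrefl refl (≤-trans 1≤k (≤-trans k≤ n≥)))
  rest-stage (suc n) w Cs N A B n≥ mx k≤ C≥ lN A≥ B≥ ends U! | yes 2k≤
    with w₁ , w₂ , refl , lw ← trim k w k≤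
    with c₁ , c₂ , refl , lc ← trim k Cs (≤-trans k≤ C≥) = advance-then a
      (rest-stage n w₂ c₂ (next a) (rest a) B
        (≤-via 1 refl (≤-trans (≤-trans (≤-reflexive (+-comm (length w₂) 1)) (+-monoˡ-≤ _ 1≤k)) (≤-trans (≤-reflexive (sym |w|)) n≥)) (sym (+-comm n 1)))
        (Mixed-++ʳ w₁ mx)
        (≤-via k refl (≤-trans (≤-reflexive (cong (k +_) (sym (+-identityʳ k)))) 2k≤) (trans |w| (+-comm k _)))
        (≤-via k (trans (+-comm _ k) (sym |w|)) C≥ (trans |C| (+-comm k _)))
        (trans (next-length a) (*-identityˡ Q))
        (≤-via k (trans (lemma (length w₂) a₀ k) (cong (_+ a₀) (sym |w|))) A≥ |A|) B≥ ends (advance-unique B a U!))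
    where
    |w| : length (w₁ ++ w₂) ≡ k + length w₂
    |w| = trans (length-++ w₁) (cong (_+ length w₂) lw)
    |C| : length (c₁ ++ c₂) ≡ k + length c₂
    |C| = trans (length-++ c₁) (cong (_+ length c₂) lc)
    lemma : ∀ x y z → (x + y) + z ≡ (z + x) + y
    lemma = solve-∀
    a : Advance N A A w₁ c₁ (2 ^ 0 * Q)
    a = k-jump w₁ c₁ N A 0 (Mixed-++ˡ w₁ mx) lw lc (unique-init N A U!) lN z≤n (≤-trans (m≤n+m a₀ _) A≥)
    |A| : length A ≡ length (rest a) + k
    |A| = +-cancelˡ-≡ Q _ _ (trans (cong (_+ length A) (sym lN)) (trans (advance-length a)
      (trans (cong₂ (λ x y → x + (y + length (rest a))) lw (*-identityˡ Q)) (lemma₂ k Q (length (rest a))))))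
      where
      lemma₂ : ∀ k q r → k + (q + r) ≡ q + (r + k)
      lemma₂ = solve-∀

  -- Fixes the first vertex y, at which an absorbing trail can then be aimed.
  Path-head : ∀ {N w cs vs} → Path N w cs vs → ∃[ y ] y ∈ N × Path [ y ] w cs vs
  Path-head (end v∈ e) = _ , v∈ , end (here refl) e
  Path-head (step u∈ a p) = _ , u∈ , step (here refl) a p

  K : ℕ
  K = 6 * k

  -- The rest of the path is completed first. A vertex x that it misses is then threaded through S
  -- by majority arcs ending at its first vertex, and these arcs take colours from D, which the rest
  -- does not touch.
  absorb-vertex : ∀ {S N' I R w' Cs'} D N g e B → suc (2 * K) ≤ length D →
    let M = Majority.majority T TS End K D in
    Absorbing g (length g) → length g ≤ K → N ↭ S ++ N' ++ I → length S ≡ length g →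
    AllPairs (Arc e M) S → All (λ s → All (Arc e M s) N') S →
    Unique (N ++ R ++ B) → (c : Completion N' (N' ++ (I ++ R) ++ B) w' Cs') → 1 ≤ length (Completion.W c) →
    Completion N (N ++ R ++ B) ((g ++ e ∷ []) ++ w') (D ++ Cs')
  absorb-vertex {S} {N'} {I} {R} {w'} {Cs'} D N g e B D≥ abs g≤ r lS tr out U! (completion vs cs (x ∷ W) E p v c) _
    with y , y∈ , p' ← Path-head p = result
    where
    open Majority T TS End K D
    open PermutationReasoning
    whole : N ++ R ++ B ↭ S ++ (N' ++ (I ++ R) ++ B)
    whole = begin
      N ++ R ++ B                  ↭⟨ PermP.++⁺ʳ (R ++ B) r ⟩
      (S ++ N' ++ I) ++ R ++ B     ↭⟨ ↭-solve 5 (λ s n i r b → (s ⊕ (n ⊕ i)) ⊕ (r ⊕ b) ⊜ s ⊕ (n ⊕ ((i ⊕ r) ⊕ b))) ↭-refl S N' I R B ⟩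
      S ++ (N' ++ (I ++ R) ++ B)   ∎
    x∉S : All (x ≢_) S
    x∉S = All.tabulate λ s∈ x≡s → unique-++-≢ S (unique-resp-↭ whole U!) s∈
      (PermP.∈-resp-↭ v (∈-++⁺ʳ vs (here refl))) (sym x≡s)
    ab : Absorption majority (g ++ e ∷ []) S x y
    ab = abs (majority-semicomplete D≥) e S lS tr x∉S (All.map (λ a → All.lookup a y∈) out)
    open Absorption ab
    coloured = colour-trail trail [] D ↭-refl (≤-trans (≤-reflexive (trans (length-++ g) (+-comm (length g) 1))) (s≤s g≤))
    gs = proj₁ coloured
    left = proj₁ (proj₂ coloured)
    first∈N : ∀ {z} → z ∈ [ first ] → z ∈ N
    first∈N (here refl) = PermP.∈-resp-↭ (↭-sym r) (∈-++⁺ˡ first∈)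
    result : Completion N (N ++ R ++ B) ((g ++ e ∷ []) ++ w') (D ++ Cs')
    result = completion ((first ∷ others) ++ vs) (gs ++ cs) W (left ++ E)
      (Path-mono first∈N (proj₂ (proj₂ (proj₂ coloured)) p'))
      (begin
        ((first ∷ others) ++ vs) ++ W     ↭⟨ PermP.++⁺ʳ W (PermP.++⁺ʳ vs spans) ⟩
        ((x ∷ S) ++ vs) ++ W              ↭⟨ ↭-solve 4 (λ x s v w → ((x ⊕ s) ⊕ v) ⊕ w ⊜ s ⊕ (v ⊕ (x ⊕ w))) ↭-refl [ x ] S vs W ⟩
        S ++ (vs ++ x ∷ W)                ↭⟨ PermP.++⁺ˡ S v ⟩
        S ++ (N' ++ (I ++ R) ++ B)        ↭⟨ whole ⟨
        N ++ R ++ B                       ∎)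
      (begin
        (gs ++ cs) ++ (left ++ E)         ↭⟨ ↭-solve 4 (λ g c l e → (g ⊕ c) ⊕ (l ⊕ e) ⊜ (g ⊕ l) ⊕ (c ⊕ e)) ↭-refl gs cs left E ⟩
        (gs ++ left) ++ (cs ++ E)         ↭⟨ PermP.++⁺ (↭-sym (proj₁ (proj₂ (proj₂ coloured)))) c ⟩
        D ++ Cs'                          ∎)

  -- The gadget uses |g| + 1 letters but sets aside only |g| vertices, since x comes from those
  -- missed by the rest. This is what lowers the deficit from `suc t` to t.
  vertex-step : ∀ {Z u cs₁ w' C'} t D N A B g e (a : Advance N A Z u cs₁ (2 ^ length g * Q)) →
    length D ≡ suc (2 * K) → Absorbing g (length g) → length g ≤ K → length N ≡ Q →
    (length u + (length g + suc (length w'))) + a₀ ≤ length A + suc t →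
    length B ≡ β → suc (suc t) ≤ Q + β + a₀ → Unique (N ++ A ++ B) →
    (∀ N' A' → length N' ≡ Q → length w' + a₀ ≤ length A' + t → Unique (N' ++ A' ++ B) →
      Completion N' (N' ++ A' ++ B) w' C') →
    Completion N (N ++ A ++ B) (u ++ (g ++ e ∷ []) ++ w') (cs₁ ++ D ++ C')
  vertex-step {u = u} {w' = w'} t D N A B g e a lD abs g≤ lN A≥ lB t≤ U! rec
    with U!a ← advance-unique B a U!
    with S , N' , I , next↭ , lS , lN' , tr , out ← transitive-list
           (dir-semicomplete e (Majority.majority-semicomplete T TS End K D (≤-reflexive (sym lD)))) (length g) Q (next a)
           (unique-++ˡ (next a) U!a) Q≥1 (≤-reflexive (sym (next-length a))) =
    advance-then a (absorb-vertex D (next a) g e B (≤-reflexive (sym lD)) abs g≤ next↭ lS tr out U!a inner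
      (W≥1 inner))
    where
    |A| : length A ≡ length u + (length g + (length I + length (rest a)))
    |A| = +-cancelˡ-≡ Q _ _ (trans (cong (_+ length A) (sym lN)) (trans (advance-length a)
      (trans (cong (λ y → length u + (y + length (rest a)))
        (trans (sym (next-length a)) (trans (PermP.↭-length next↭) (trans (length-++ S) (cong₂ _+_ lS (trans (length-++ N') (cong (_+ length I) lN')))))))
        (regroup (length u) (length g) Q (length I) (length (rest a))))))
      where
      regroup : ∀ x g q i r → x + ((g + (q + i)) + r) ≡ q + (x + (g + (i + r)))
      regroup = solve-∀

    A'≥ : length w' + a₀ ≤ length (I ++ rest a) + t
    A'≥ = ≤-via (length u + length g + 1) (l (length u) (length g) (length w') a₀)
      (≤-trans A≥ (≤-reflexive (cong (_+ suc t) |A|)))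
      (trans (l' (length u) (length g) (length I + length (rest a)) t)
        (cong (λ z → (z + t) + (length u + length g + 1)) (sym (length-++ I))))
      where
      l : ∀ u g w a → (w + a) + (u + g + 1) ≡ (u + (g + suc w)) + a
      l = solve-∀
      l' : ∀ u g i t → (u + (g + i)) + suc t ≡ (i + t) + (u + g + 1)
      l' = solve-∀

    inner : Completion N' (N' ++ (I ++ rest a) ++ B) w' _
    inner = rec N' (I ++ rest a) lN' A'≥ (unique-++ʳ S (unique-resp-↭ (↭-trans (PermP.++⁺ʳ (rest a ++ B) next↭)
      (↭-solve 5 (λ s n i r b → (s ⊕ (n ⊕ i)) ⊕ (r ⊕ b) ⊜ s ⊕ (n ⊕ ((i ⊕ r) ⊕ b))) ↭-refl S N' I (rest a) B)) U!a))

    -- The rest has Q + |A'| + β vertices at its disposal and uses |w'| + 1. The surplus is at least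
    -- Q + β + a₀ - t - 1, which the hypothesis on t makes positive.
    W≥1 : (c : Completion N' (N' ++ (I ++ rest a) ++ B) w' _) → 1 ≤ length (Completion.W c)
    W≥1 c = count-left (length w') (length (Completion.W c)) t (length (I ++ rest a)) Q β a₀
      (trans (leftover-vertices c) (trans (length-++ N') (cong₂ _+_ lN' (trans (length-++ (I ++ rest a)) (cong (length (I ++ rest a) +_) lB)))))
      A'≥ t≤
      where
      count-left : ∀ w x t y q β a → suc w + x ≡ q + (y + β) → w + a ≤ y + t → suc (suc t) ≤ q + β + a → 1 ≤ x
      count-left w x t y q β a eq h₁ h₂ = ≤-via (suc w + t) (l w t) (≤-trans (+-monoʳ-≤ w h₂)
          (≤-trans (≤-reflexive (l₂ w q β a)) (+-monoʳ-≤ (q + β) h₁)))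
          (trans (l₃ q β y t) (trans (cong (_+ t) (sym eq)) (l₄ w x t)))
        where
        l : ∀ w t → 1 + (suc w + t) ≡ w + suc (suc t)
        l = solve-∀
        l₂ : ∀ w q β a → w + (q + β + a) ≡ (q + β) + (w + a)
        l₂ = solve-∀
        l₃ : ∀ q β y t → (q + β) + (y + t) ≡ (q + (y + β)) + t
        l₃ = solve-∀
        l₄ : ∀ w x t → (suc w + x) + t ≡ x + (suc w + t)
        l₄ = solve-∀

  -- The jump leaves room for |pre| + n halvings: |pre| for the walk up to the gadget and n for the
  -- selection that follows.
  approach : ∀ w₁ c₁ pre c₂ N A n → Mixed k w₁ → length w₁ ≡ k → length c₁ ≡ k → length c₂ ≡ length pre →
    Unique (N ++ A) → length N ≡ Q → length pre + n ≤ 6 * k → a₀ ≤ length A →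
    ∃[ Z ] Advance N A Z (w₁ ++ pre) (c₁ ++ c₂) (2 ^ n * Q)
  approach w₁ c₁ pre c₂ N A n mx lw₁ lc₁ lc₂ U! lN ≤6k A≥
    with a₁ ← k-jump w₁ c₁ N A (length pre + n) mx lw₁ lc₁ U! lN ≤6k A≥ =
    _ , Advance-++ a₁ (walk pre c₂ (next a₁) (rest a₁) (2 ^ n * Q) lc₂ (unique-++ˡ (next a₁) (Advance-unique a₁ U!))
      (*-mono-≤ (m^n>0 2 n) Q≥1) (≤-reflexive (trans (sym (*-assoc (2 ^ length pre) (2 ^ n) Q))
        (trans (cong (_* Q) (sym (^-distribˡ-+-* 2 (length pre) n))) (sym (next-length a₁))))))

  trim₃ : ∀ {X : Set} a b c (xs : List X) → a + (b + c) ≤ length xs →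
    ∃[ x₁ ] ∃[ x₂ ] ∃[ x₃ ] ∃[ x₄ ] xs ≡ (x₁ ++ x₂) ++ x₃ ++ x₄ ×
      length x₁ ≡ a × length x₂ ≡ b × length x₃ ≡ c × length xs ≡ a + (b + (c + length x₄))
  trim₃ a b c xs l
    with x₁ , ys , refl , l₁ ← trim a xs (≤-trans (m≤m+n a _) l)
    with l' ← trans (length-++ x₁) (cong (_+ length ys) l₁)
    with b+c≤ ← +-cancelˡ-≤ a _ _ (≤-trans l (≤-reflexive l'))
    with x₂ , zs , refl , l₂ ← trim b ys (≤-trans (m≤m+n b c) b+c≤)
    with l'' ← trans (length-++ x₂ {zs}) (cong (_+ length zs) l₂)
    with x₃ , x₄ , refl , l₃ ← trim c zs (+-cancelˡ-≤ b _ _ (≤-trans b+c≤ (≤-reflexive l''))) =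
    x₁ , x₂ , x₃ , x₄ , sym (++-assoc x₁ x₂ _) , l₁ , l₂ , l₃ ,
    trans l' (cong (a +_) (trans l'' (cong (b +_) (trans (length-++ x₃) (cong (_+ length x₄) l₃)))))

  -- The first k letters are spent on a jump and a gadget lies within the next 6k, so one absorbed
  -- vertex costs at most 7k letters.
  locate-gadget : ∀ w → Mixed k w → 7 * k ≤ length w →
    ∃[ w₁ ] ∃[ pre ] ∃[ g ] ∃[ e ] ∃[ w' ] w ≡ (w₁ ++ pre) ++ (g ++ e ∷ []) ++ w' × length w₁ ≡ k ×
      length pre + length g ≤ 6 * k × length w ≡ k + (length pre + (length g + suc (length w'))) ×
      length w ≤ 7 * k + length w' × Absorbing g (length g)
  locate-gadget w mx w≥
    with w₁ , w₂ , [] , w₃ , refl , lw₁ , lw₂ , _ , |w| ← trim₃ k (6 * k) 0 w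
           (≤-trans (≤-reflexive (cong (k +_) (+-identityʳ (6 * k)))) w≥)
    with find-gadget w₂ (Mixed-++ʳ w₁ (Mixed-++ˡ (w₁ ++ w₂) mx)) 1≤k lw₂
  ... | record { pre = pre ; g = g ; post = post ; e = e ; factorises = refl ; absorbing = abs } =
    w₁ , pre , g , e , post ++ w₃ , w≡ , lw₁ ,
    ≤-trans (+-monoʳ-≤ (length pre) (m≤m+n (length g) (suc (length post)))) (≤-reflexive (sym |w₂|)) ,
    trans |w| (cong (k +_) (trans (cong (_+ length w₃) |w₂|) (trans (l (length pre) (length g) (length post) (length w₃))
      (cong (λ z → length pre + (length g + suc z)) (sym (length-++ post)))))) ,
    ≤-trans (≤-reflexive (trans |w| (sym (+-assoc k (6 * k) (length w₃)))))
      (+-monoʳ-≤ (7 * k) (≤-trans (m≤n+m _ (length post)) (≤-reflexive (sym (length-++ post))))) ,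
    abs
    where
    |w₂| : 6 * k ≡ length pre + (length g + suc (length post))
    |w₂| = trans (sym lw₂) (trans (length-++ pre) (cong (length pre +_) (length-++ g)))
    l : ∀ a g p w → (a + (g + suc p)) + w ≡ a + (g + suc (p + w))
    l = solve-∀
    w≡ : (w₁ ++ (pre ++ g ++ e ∷ post)) ++ w₃ ≡ (w₁ ++ pre) ++ (g ++ e ∷ []) ++ (post ++ w₃)
    w≡ = trans (++-assoc w₁ _ w₃) (trans (cong (w₁ ++_) (trans (++-assoc pre (g ++ e ∷ post) w₃) (cong (pre ++_)
      (trans (++-assoc g (e ∷ post) w₃) (sym (++-assoc g (e ∷ []) (post ++ w₃))))))) (sym (++-assoc w₁ pre _)))

  private
    room : ∀ k a g w s t → k + (a + s) ≤ (k + (a + (g + suc w))) + (s + t)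
    room k a g w s t = ≤-trans (m≤m+n _ (g + suc w + t)) (≤-reflexive (l k a g w s t))
      where
      l : ∀ k a g w s t → (k + (a + s)) + (g + suc w + t) ≡ (k + (a + (g + suc w))) + (s + t)
      l = solve-∀
    room' : ∀ k a g w s t c → (k + (a + (g + suc w))) + (s + t) ≤ k + (a + (s + c)) → w + t ≤ c
    room' k a g w s t c h = ≤-trans (m≤m+n _ (suc g)) (≤-via (k + a + s) (l k a g w s t) h (l' k a s c))
      where
      l : ∀ k a g w s t → ((w + t) + suc g) + (k + a + s) ≡ (k + (a + (g + suc w))) + (s + t)
      l = solve-∀
      l' : ∀ k a s c → k + (a + (s + c)) ≡ c + (k + a + s)
      l' = solve-∀

  -- t is the number of vertices still to be absorbed.
  vertex-stage : ∀ t w Cs N A B → Mixed k w → t * (7 * k) + k ≤ length w →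
    length w + t * suc (2 * K) ≤ length Cs → length N ≡ Q → length w + a₀ ≤ length A + t →
    length B ≡ β → suc t ≤ Q + β + a₀ → All End B → Unique (N ++ A ++ B) →
    Completion N (N ++ A ++ B) w Cs
  vertex-stage zero w Cs N A B mx w≥ C≥ lN A≥ lB t≤ ends U! =
    rest-stage (length w) w Cs N A B ≤-refl mx w≥ (≤-trans (≤-reflexive (sym (+-identityʳ _))) C≥) lN
      (≤-trans A≥ (≤-reflexive (+-identityʳ _))) (≤-reflexive (sym lB)) ends U!
  vertex-stage (suc t) w Cs N A B mx w≥ C≥ lN A≥ lB t≤ ends U!
    with w₁ , pre , g , e , w' , w≡ , lw₁ , ≤6k , |w| , |w|≤ , abs ← locate-gadget w mx
           (≤-trans (≤-trans (m≤m+n (7 * k) (t * (7 * k) + k)) (≤-reflexive (sym (+-assoc (7 * k) _ k)))) w≥)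
    with c₁ , c₂ , D , C' , C≡ , lc₁ , lc₂ , lD , |C| ← trim₃ k (length pre) (suc (2 * K)) Cs
           (≤-trans (room k (length pre) (length g) (length w') (suc (2 * K)) (t * suc (2 * K)))
             (≤-trans (≤-reflexive (cong (_+ (suc (2 * K) + t * suc (2 * K))) (sym |w|))) C≥))
    with _ , a ← approach w₁ c₁ pre c₂ N A (length g) (Mixed-++ˡ w₁ (Mixed-++ˡ (w₁ ++ pre) (subst (Mixed k) w≡ mx)))
           lw₁ lc₁ lc₂ (unique-init N A U!) lN ≤6k
           -- Since 7k letters are kept for each vertex to be absorbed, `suc t` is at most |w|;
           -- hence |A| is at least a₀.
           (+-cancelʳ-≤ (suc t) _ _ (≤-trans (≤-trans (+-monoʳ-≤ a₀ (≤-trans (≤-reflexive (sym (*-identityʳ (suc t))))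
             (≤-trans (*-monoʳ-≤ (suc t) (≤-trans 1≤k (m≤m+n k _))) (≤-trans (m≤m+n _ k) w≥)))) (≤-reflexive (+-comm a₀ _))) A≥)) =
    Completion-cast (sym w≡) (↭-reflexive (sym C≡)) (vertex-step t D N A B g e a lD abs (≤-trans (m≤n+m _ (length pre)) ≤6k) lN
      (≤-trans (≤-reflexive (cong (_+ a₀) (trans (cong (_+ (length g + suc (length w'))) (trans (length-++ w₁) (cong (_+ length pre) lw₁)))
        (trans (+-assoc k _ _) (sym |w|))))) A≥) lB t≤ U!
      λ N' A' lN' A'≥ U!' → vertex-stage t w' C' N' A' B
        (Mixed-++ʳ (g ++ e ∷ []) (Mixed-++ʳ (w₁ ++ pre) (subst (Mixed k) w≡ mx)))
        (+-cancelˡ-≤ (7 * k) _ _ (≤-trans (≤-reflexive (sym (+-assoc (7 * k) _ k))) (≤-trans w≥ |w|≤)))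
        (room' k (length pre) (length g) (length w') (suc (2 * K)) (t * suc (2 * K)) (length C')
          (≤-trans (≤-reflexive (cong (_+ (suc (2 * K) + t * suc (2 * K))) (sym |w|))) (≤-trans C≥ (≤-reflexive |C|))))
        lN' A'≥ lB (≤-trans (n≤1+n _) t≤) ends U!')

module ColourStage {V C : Set} (T : C → V → V → Bool) (TS : ∀ c → Semicomplete (T c)) (End : V → Set)
                   (k : ℕ) (1≤k : 1 ≤ k) (sizes : Sizes k) where
  open Rainbow T TS End
  open Sizes sizes
  open Stages T TS End k 1≤k sizes

  -- The arc between s₁ and s₂ may take any colour, since the two vertices may be exchanged.
  absorb-colour : ∀ {s₁ s₂ N' I R w' Cs'} N b e d B → N ↭ s₁ ∷ s₂ ∷ N' ++ I → s₁ ≢ s₂ →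
    All (Arc e (T d) s₁) N' → All (Arc e (T d) s₂) N' →
    (c : Completion N' (N' ++ (I ++ R) ++ B) w' Cs') → 1 ≤ length (Completion.E c) →
    Completion N (N ++ R ++ B) (b ∷ e ∷ w') (d ∷ Cs')
  absorb-colour {s₁} {s₂} {N'} {I} {R} {w'} {Cs'} N b e d B r s₁≢s₂ a₁ a₂ (completion vs cs W (c ∷ E) p v r') _
    = place (Arc-total (TS c) b s₁≢s₂)
    where
    open PermutationReasoning
    vertices : s₁ ∷ s₂ ∷ vs ++ W ↭ N ++ R ++ B
    vertices = begin
      s₁ ∷ s₂ ∷ vs ++ W                            ↭⟨ prep s₁ (prep s₂ v) ⟩
      s₁ ∷ s₂ ∷ (N' ++ (I ++ R) ++ B)
        ↭⟨ prep s₁ (prep s₂ (↭-solve 4 (λ n i r b → n ⊕ ((i ⊕ r) ⊕ b) ⊜ (n ⊕ i) ⊕ (r ⊕ b)) ↭-refl N' I R B)) ⟩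
      (s₁ ∷ s₂ ∷ N' ++ I) ++ R ++ B                ↭⟨ PermP.++⁺ʳ (R ++ B) r ⟨
      N ++ R ++ B                                  ∎
    colours' : c ∷ d ∷ cs ++ E ↭ d ∷ Cs'
    colours' = ↭-trans (swap c d ↭-refl) (prep d (↭-trans (↭-sym (PermP.shift c cs E)) r'))
    place : Arc b (T c) s₁ s₂ ⊎ Arc b (T c) s₂ s₁ → Completion N (N ++ R ++ B) (b ∷ e ∷ w') (d ∷ Cs')
    place (inj₁ a) = completion (s₁ ∷ s₂ ∷ vs) (c ∷ d ∷ cs) W E
      (step (PermP.∈-resp-↭ (↭-sym r) (here refl)) (a ∷ []) (step (here refl) a₂ p)) vertices colours'
    place (inj₂ a) = completion (s₂ ∷ s₁ ∷ vs) (c ∷ d ∷ cs) W E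
      (step (PermP.∈-resp-↭ (↭-sym r) (there (here refl))) (a ∷ []) (step (here refl) a₁ p))
      (↭-trans (swap s₂ s₁ ↭-refl) vertices) colours'

  colour-step : ∀ {Z w₁ cs₁ w' C'} s t γ N A B b e d (a : Advance N A Z w₁ cs₁ (2 ^ 2 * Q)) → length N ≡ Q →
    (length w₁ + (2 + length w')) + a₀ ≤ length A + t → length w' + s ≤ length C' + γ → suc γ ≤ s →
    Unique (N ++ A ++ B) →
    (∀ N' A' → length N' ≡ Q → length w' + a₀ ≤ length A' + t → Unique (N' ++ A' ++ B) →
      Completion N' (N' ++ A' ++ B) w' C') →
    Completion N (N ++ A ++ B) (w₁ ++ b ∷ e ∷ w') (cs₁ ++ d ∷ C')
  colour-step {w₁ = w₁} {w' = w'} s t γ N A B b e d a lN A≥ C≥ γ< U! rec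
    with U!a ← advance-unique B a U!
    with s₁ , O₁ , I₁ , r₁ , lO₁ , out₁ ← large-outdegree (dir-semicomplete e (TS d)) (2 * Q) (next a)
           (unique-++ˡ (next a) U!a) (≤-trans Q≥1 (m≤m+n Q _))
           (≤-reflexive (trans (sym (*-assoc 2 2 Q)) (sym (next-length a))))
    with s₂ , O₂ , I₂ , r₂ , lO₂ , out₂ ← large-outdegree (dir-semicomplete e (TS d)) Q O₁
           (unique-++ˡ O₁ (unique-++ʳ [ s₁ ] (unique-resp-↭ r₁ (unique-++ˡ (next a) U!a)))) Q≥1 (≤-reflexive (sym lO₁)) =
    advance-then a (absorb-colour (next a) b e d B next↭ s₁≢s₂ (AllP.++⁻ˡ O₂ (All.tail (PermP.All-resp-↭ r₂ out₁))) out₂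
      inner (E≥1 inner))
    where
    I = I₂ ++ I₁
    next↭ : next a ↭ s₁ ∷ s₂ ∷ O₂ ++ I
    next↭ = ↭-trans r₁ (prep s₁ (↭-trans (PermP.++⁺ʳ I₁ r₂) (prep s₂ (PermP.++-assoc O₂ I₂ I₁))))
    s₁≢s₂ : s₁ ≢ s₂
    s₁≢s₂ = unique-++-≢ [ s₁ ] (unique-resp-↭ next↭ (unique-++ˡ (next a) U!a)) (here refl) (here refl)
    |A| : length A ≡ length w₁ + (2 + (length I + length (rest a)))
    |A| = +-cancelˡ-≡ Q _ _ (trans (cong (_+ length A) (sym lN)) (trans (advance-length a)
      (trans (cong (λ y → length w₁ + (y + length (rest a)))
        (trans (sym (next-length a)) (trans (PermP.↭-length next↭) (cong (2 +_) (trans (length-++ O₂) (cong (_+ length I) lO₂))))))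
        (regroup (length w₁) Q (length I) (length (rest a))))))
      where
      regroup : ∀ x q i r → x + ((2 + (q + i)) + r) ≡ q + (x + (2 + (i + r)))
      regroup = solve-∀
    A-room : length w' + a₀ ≤ length (I ++ rest a) + t
    A-room = ≤-via (length w₁ + 2) (l (length w₁) (length w') a₀) (≤-trans A≥ (≤-reflexive (cong (_+ t) |A|)))
      (trans (l' (length w₁) (length I + length (rest a)) t) (cong (λ z → (z + t) + (length w₁ + 2)) (sym (length-++ I))))
      where
      l : ∀ k w s → (w + s) + (k + 2) ≡ (k + (2 + w)) + s
      l = solve-∀
      l' : ∀ k c g → (k + (2 + c)) + g ≡ (c + g) + (k + 2)
      l' = solve-∀
    inner : Completion O₂ (O₂ ++ (I ++ rest a) ++ B) w' _
    inner = rec O₂ (I ++ rest a) lO₂ A-room (unique-++ʳ (s₁ ∷ s₂ ∷ []) (unique-resp-↭ (↭-trans (PermP.++⁺ʳ (rest a ++ B) next↭)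
      (prep s₁ (prep s₂ (↭-solve 4 (λ n i r b → (n ⊕ i) ⊕ (r ⊕ b) ⊜ n ⊕ ((i ⊕ r) ⊕ b)) ↭-refl O₂ I (rest a) B)))) U!a))
    -- As γ is less than s, there are more colours in C' than letters in w'.
    E≥1 : (c : Completion O₂ (O₂ ++ (I ++ rest a) ++ B) w' _) → 1 ≤ length (Completion.E c)
    E≥1 c = ≤-via (length w' + γ) refl (≤-trans (≤-reflexive (sym (+-suc (length w') γ)))
      (≤-trans (+-monoʳ-≤ (length w') γ<) C≥))
      (trans (cong (_+ γ) (sym (leftover-colours c))) (l (length w') (length (Completion.E c)) γ))
      where
      l : ∀ w e g → (w + e) + g ≡ e + (w + g)
      l = solve-∀

  split-at : ∀ {X : Set} n (xs : List X) → suc n ≤ length xs →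
    ∃[ x₁ ] ∃[ y ] ∃[ x₂ ] xs ≡ x₁ ++ y ∷ x₂ × length x₁ ≡ n × length xs ≡ n + suc (length x₂)
  split-at zero (x ∷ xs) _ = [] , x , xs , refl , refl , refl
  split-at (suc n) (x ∷ xs) (s≤s l) with x₁ , y , x₂ , e , l₁ , l₂ ← split-at n xs l =
    x ∷ x₁ , y , x₂ , cong (x ∷_) e , cong suc l₁ , cong suc l₂

  split-at-two : ∀ {X : Set} n (xs : List X) → 2 + n ≤ length xs →
    ∃[ x₁ ] ∃[ y ] ∃[ z ] ∃[ x₂ ] xs ≡ x₁ ++ y ∷ z ∷ x₂ × length x₁ ≡ n × length xs ≡ n + (2 + length x₂)
  split-at-two zero (_ ∷ []) (s≤s ())
  split-at-two zero (x ∷ y ∷ xs) _ = [] , x , y , xs , refl , refl , refl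
  split-at-two (suc n) (x ∷ xs) (s≤s l) with x₁ , y , z , x₂ , e , l₁ , l₂ ← split-at-two n xs l =
    x ∷ x₁ , y , z , x₂ , cong (x ∷_) e , cong suc l₁ , cong suc l₂

  -- γ is the number of colours still to be absorbed.
  colour-stage : ∀ γ t w Cs N A B → Mixed k w → γ * (k + 2) + (t * (7 * k) + k) ≤ length w →
    length w + t * suc (2 * K) ≤ length Cs + γ → γ ≤ t * suc (2 * K) → length N ≡ Q →
    length w + a₀ ≤ length A + t → length B ≡ β → suc t ≤ Q + β + a₀ → All End B → Unique (N ++ A ++ B) →
    Completion N (N ++ A ++ B) w Cs
  colour-stage zero t w Cs N A B mx w≥ C≥ γ≤ lN A≥ lB t≤ ends U! =
    vertex-stage t w Cs N A B mx w≥ (≤-trans C≥ (≤-reflexive (+-identityʳ _))) lN A≥ lB t≤ ends U!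
  colour-stage (suc γ) t w Cs N A B mx w≥ C≥ γ≤ lN A≥ lB t≤ ends U!
    with w≥' ← ≤-trans (≤-reflexive (sym (+-assoc (k + 2) (γ * (k + 2)) (t * (7 * k) + k)))) w≥
    with k+2≤ ← ≤-trans (≤-trans (≤-reflexive (+-comm 2 k)) (m≤m+n (k + 2) _)) w≥'
    with w≤C ← +-cancelʳ-≤ (suc γ) (length w) (length Cs) (≤-trans (+-monoʳ-≤ (length w) γ≤) C≥)
    with w₁ , b , e , w' , w≡ , lw₁ , |w| ← split-at-two k w k+2≤
    with c₁ , d , C' , C≡ , lc₁ , |C| ← split-at k Cs (≤-trans (n≤1+n _) (≤-trans k+2≤ w≤C))
    with mx' ← subst (Mixed k) w≡ mx
    with a ← k-jump w₁ c₁ N A 2 (Mixed-++ˡ w₁ mx') lw₁ lc₁ (unique-init N A U!) lN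
           (≤-trans (s≤s (s≤s z≤n)) (*-monoʳ-≤ 6 1≤k))
           (+-cancelʳ-≤ t _ _ (≤-trans (≤-trans (+-monoʳ-≤ a₀ (≤-trans (≤-trans (≤-reflexive (sym (*-identityʳ t)))
             (*-monoʳ-≤ t (≤-trans 1≤k (m≤m+n k _)))) (≤-trans (m≤m+n (t * (7 * k)) k) (≤-trans (m≤n+m (t * (7 * k) + k) (suc γ * (k + 2))) w≥))))
             (≤-reflexive (+-comm a₀ _))) A≥)) =
    Completion-cast (sym w≡) (↭-reflexive (sym C≡)) (colour-step (t * suc (2 * K)) t γ N A B b e d a lN
      (≤-trans (≤-reflexive (cong (_+ a₀) (trans (cong (_+ (2 + length w')) lw₁) (sym |w|)))) A≥) C'≥ γ≤ U!
      λ N' A' lN' A'≥ U!' → colour-stage γ t w' C' N' A' B (Mixed-++ʳ (b ∷ e ∷ []) (Mixed-++ʳ w₁ mx'))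
        (+-cancelˡ-≤ (k + 2) _ _ (≤-trans w≥' (≤-reflexive (trans |w| (sym (+-assoc k 2 (length w')))))))
        C'≥ (≤-trans (n≤1+n γ) γ≤) lN' A'≥ lB t≤ ends U!')
    where
    C'≥ : length w' + t * suc (2 * K) ≤ length C' + γ
    C'≥ = ≤-via (k + 2) (l k (length w') (t * suc (2 * K)))
      (≤-trans (≤-reflexive (cong (_+ t * suc (2 * K)) (sym |w|))) (≤-trans C≥ (≤-reflexive (cong (_+ suc γ) |C|))))
      (l' k (length C') γ)
      where
      l : ∀ k w s → (w + s) + (k + 2) ≡ (k + (2 + w)) + s
      l = solve-∀
      l' : ∀ k c g → (k + suc c) + suc g ≡ (c + g) + (k + 2)
      l' = solve-∀

-- Blocks

module _ {m : ℕ} (o : OrientedPath m) where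

  private
    Run : Bool → ℕ → ℕ → Set
    Run c i ℓ = ∀ j (pj : j < m) → i ≤ j → j < i + ℓ → arcDir o j pj ≡ c

    Run-left : ∀ {c} i ℓ (p : i < m) → arcDir o i p ≡ c → Run c (suc i) ℓ → Run c i (suc ℓ)
    Run-left i ℓ p eq run j pj i≤j j< with m≤n⇒m<n∨m≡n i≤j
    ... | inj₁ i<j = run j pj i<j (≤-trans j< (≤-reflexive (+-suc i ℓ)))
    ... | inj₂ refl = eq

    Run-right : ∀ {c} i ℓ (p : i + ℓ < m) → arcDir o (i + ℓ) p ≡ c → Run c i ℓ → Run c i (suc ℓ)
    Run-right i ℓ p eq run j pj i≤j j< with m≤n⇒m<n∨m≡n (≤-pred (≤-trans j< (≤-reflexive (+-suc i ℓ))))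
    ... | inj₁ j<' = run j pj i≤j j<'
    ... | inj₂ refl = eq

  extend-left : ∀ {c} i ℓ → i + ℓ ≤ m → Run c i ℓ →
    ∃[ i' ] ∃[ ℓ' ] ℓ ≤ ℓ' × i' + ℓ' ≤ m × Run c i' ℓ' × (∀ j (pj : j < m) → suc j ≡ i' → arcDir o j pj ≢ c)
  extend-left zero ℓ le run = zero , ℓ , ≤-refl , le , run , λ _ _ ()
  extend-left {c} (suc i) ℓ le run with p ← ≤-trans (m≤m+n (suc i) ℓ) le with arcDir o i p Bool.≟ c
  ... | no ne = suc i , ℓ , ≤-refl , le , run , λ { _ _ refl → ne }
  ... | yes eq with i' , ℓ' , l , r ← extend-left i (suc ℓ) (≤-trans (≤-reflexive (+-suc i ℓ)) le) (Run-left i ℓ p eq run) =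
    i' , ℓ' , ≤-trans (n≤1+n ℓ) l , r

  -- The number f of arcs to the right of the run drives the recursion.
  extend-right : ∀ {c} f i ℓ → i + ℓ + f ≡ m → Run c i ℓ →
    ∃[ ℓ' ] ℓ ≤ ℓ' × i + ℓ' ≤ m × Run c i ℓ' × (∀ (pk : i + ℓ' < m) → arcDir o (i + ℓ') pk ≢ c)
  extend-right zero i ℓ eq run = ℓ , ≤-refl , ≤-reflexive (trans (sym (+-identityʳ _)) eq) , run ,
    λ pk → ⊥-elim (<-irrefl (trans (sym (+-identityʳ _)) eq) pk)
  extend-right {c} (suc f) i ℓ eq run
    with p ← ≤-trans (m≤m+n (suc (i + ℓ)) f) (≤-reflexive (trans (sym (+-suc (i + ℓ) f)) eq))
    with arcDir o (i + ℓ) p Bool.≟ c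
  ... | no ne = ℓ , ≤-refl , ≤-trans (m≤m+n _ (suc f)) (≤-reflexive eq) , run , λ _ → ne
  ... | yes e with ℓ' , l , r ← extend-right f i (suc ℓ)
                     (trans (cong (_+ f) (+-suc i ℓ)) (trans (sym (+-suc (i + ℓ) f)) eq)) (Run-right i ℓ p e run) =
    ℓ' , ≤-trans (n≤1+n ℓ) l , r

  run⇒block : ∀ {c} i ℓ → 1 ≤ ℓ → i + ℓ ≤ m → Run c i ℓ → ∃[ i' ] ∃[ L ] ℓ ≤ L × IsBlock o i' L
  run⇒block {c} i ℓ 1≤ℓ le run
    with i' , ℓ₁ , l₁ , le₁ , run₁ , maxˡ ← extend-left i ℓ le run
    with L , l₂ , le₂ , run₂ , maxʳ ← extend-right (m ∸ (i' + ℓ₁)) i' ℓ₁ (m+[n∸m]≡n le₁) run₁ =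
    i' , L , ≤-trans l₁ l₂ , record
      { nonempty = 1≤L
      ; inRange = le₂
      ; directed = λ j k pj pk i≤j j< i≤k k< → trans (run₂ j pj i≤j j<) (sym (run₂ k pk i≤k k<))
      ; maxLeft = λ j pj pi eq e → maxˡ j pj eq (trans e (start pi))
      ; maxRight = λ pk pi e → maxʳ pk (trans e (start pi)) }
    where
    1≤L : 1 ≤ L
    1≤L = ≤-trans 1≤ℓ (≤-trans l₁ l₂)
    start : (pi : i' < m) → arcDir o i' pi ≡ c
    start pi = run₂ i' pi ≤-refl (≤-trans (≤-reflexive (+-comm 1 i')) (+-monoʳ-≤ i' 1≤L))

arcDir∈ : ∀ {m} (o : OrientedPath m) pre mid post → tabulate o ≡ pre ++ mid ++ post →
          ∀ j (pj : j < m) → length pre ≤ j → j < length pre + length mid → arcDir o j pj ∈ mid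
arcDir∈ {suc m} o (x ∷ pre) mid post eq (suc j) (s≤s pj) (s≤s l) (s≤s r) =
  arcDir∈ (λ i → o (fsuc i)) pre mid post (∷-injectiveʳ eq) j pj l r
arcDir∈ {suc m} o [] (x ∷ mid) post eq zero _ _ _ = here (∷-injectiveˡ eq)
arcDir∈ {suc m} o [] (x ∷ mid) post eq (suc j) (s≤s pj) _ (s≤s r) =
  there (arcDir∈ (λ i → o (fsuc i)) [] mid post (∷-injectiveʳ eq) j pj z≤n r)

-- A factor without the letter b is a directed run, and a run of length at least k extends to a
-- block of length at least k.
short-blocks⇒Mixed : ∀ {m} (o : OrientedPath m) k → 1 ≤ k → (∀ i L → IsBlock o i L → L < k) → Mixed k (tabulate o)
short-blocks⇒Mixed {m} o k 1≤k short pre mid post eq k≤ b with any? (b Bool.≟_) mid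
... | yes b∈ = b∈
... | no b∉ = ⊥-elim (contra (run⇒block o (length pre) (length mid) (≤-trans 1≤k k≤) in-range run))
  where
  contra : (∃[ i ] ∃[ L ] length mid ≤ L × IsBlock o i L) → ⊥
  contra (i , L , l , blk) = <-irrefl refl (≤-trans (short i L blk) (≤-trans k≤ l))
  run : ∀ j (pj : j < m) → length pre ≤ j → j < length pre + length mid → arcDir o j pj ≡ not b
  run j pj l r = ¬-not λ e → b∉ (subst (_∈ mid) e (arcDir∈ o pre mid post eq j pj l r))
  in-range : length pre + length mid ≤ m
  in-range = ≤-trans (m≤m+n _ (length post)) (≤-reflexive (begin
    length pre + length mid + length post    ≡⟨ +-assoc (length pre) _ _ ⟩
    length pre + (length mid + length post)  ≡⟨ cong (length pre +_) (length-++ mid) ⟨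
    length pre + length (mid ++ post)        ≡⟨ length-++ pre ⟨
    length (pre ++ mid ++ post)              ≡⟨ cong length eq ⟨
    length (tabulate o)                      ≡⟨ length-tabulate o ⟩
    m                                        ∎))
    where open ≡-Reasoning

-- The first vertex

separate : {X : Set} {P : X → Set} → (∀ x → Dec (P x)) → ∀ xs →
           ∃[ ys ] ∃[ zs ] xs ↭ ys ++ zs × All P ys × All (λ x → ¬ P x) zs
separate P? [] = [] , [] , ↭-refl , [] , []
separate P? (x ∷ xs) with ys , zs , r , a , b ← separate P? xs with P? x
... | yes p = x ∷ ys , zs , prep x r , p ∷ a , b
... | no ¬p = ys , x ∷ zs , ↭-trans (prep x r) (↭-sym (PermP.shift x ys zs)) , a , ¬p ∷ b

count-all : {X : Set} (p : X → Bool) → ∀ {xs} → All (λ x → p x ≡ true) xs → count p xs ≡ length xs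
count-all p [] = refl
count-all p (h ∷ hs) rewrite h = cong suc (count-all p hs)

-- Any 2q vertices contain one with q out-neighbours among them, so they cannot all have small
-- outdegree.
few-small-outdegrees : {V : Set} {R : V → V → Bool} → Semicomplete R → ∀ q {U} good bad → 1 ≤ q → Unique bad →
  U ↭ good ++ bad → All (λ u → ¬ q ≤ count (R u) U) bad → length bad < 2 * q
few-small-outdegrees {R = R} S q {U} good bad 1≤q bad! r small with 2 * q ≤? length bad
... | no few = ≰⇒> few
... | yes many with u , O , I , r' , lO , out ← large-outdegree S q bad bad! 1≤q many =
  ⊥-elim (All.head (PermP.All-resp-↭ r' small) (begin
    q                                                  ≡⟨ lO ⟨
    length O                                           ≡⟨ count-all (R u) out ⟨
    count (R u) O                                      ≤⟨ m≤m+n _ _ ⟩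
    count (R u) O + count (R u) (I ++ u ∷ good)        ≡⟨ count-++ (R u) O (I ++ u ∷ good) ⟨
    count (R u) (O ++ I ++ u ∷ good)                   ≡⟨ count-resp-↭ (R u) regroup ⟨
    count (R u) U                                      ∎))
  where
  open ≤-Reasoning
  regroup : U ↭ O ++ I ++ u ∷ good
  regroup = ↭-trans r (↭-trans (PermP.++⁺ˡ good r')
    (↭-solve 4 (λ g u o i → g ⊕ (u ⊕ (o ⊕ i)) ⊜ o ⊕ (i ⊕ (u ⊕ g))) ↭-refl good [ u ] O I))

outdegree-outside : {V : Set} {R : V → V → Bool} → Semicomplete R → ∀ q {β u U Y} B → length B ≡ β →
  U ↭ u ∷ B ++ Y → q + β ≤ count (R u) U → q ≤ count (R u) Y
outdegree-outside {R = R} S q {β} {u} {U} {Y} B lB r h = +-cancelʳ-≤ β q _ (begin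
  q + β                                     ≤⟨ h ⟩
  count (R u) U                             ≡⟨ count-resp-↭ (R u) r ⟩
  bit (R u u) + count (R u) (B ++ Y)        ≡⟨ cong (λ b → bit b + count (R u) (B ++ Y)) (irreflexive S u) ⟩
  count (R u) (B ++ Y)                      ≡⟨ count-++ (R u) B Y ⟩
  count (R u) B + count (R u) Y             ≤⟨ +-monoˡ-≤ _ (≤-trans (count≤length (R u) B) (≤-reflexive lB)) ⟩
  β + count (R u) Y                         ≡⟨ +-comm β _ ⟩
  count (R u) Y + β                         ∎)
  where open ≤-Reasoning

-- Supplies the first vertex u: N are candidates for the second vertex and B for the last. Fewer
-- than 2 (q + β) vertices have small outdegree in R₁, and among the others some u has β
-- out-neighbours in R₂. The extra β in the first threshold ensures that q out-neighbours survive
-- the removal of B.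
common-large-outdegree : {V : Set} {R₁ R₂ : V → V → Bool} → Semicomplete R₁ → Semicomplete R₂ → ∀ q β U → Unique U →
  1 ≤ q → 1 ≤ β → 2 * (q + β) + 2 * β ≤ length U →
  ∃[ u ] ∃[ N ] ∃[ A ] ∃[ B ] U ↭ u ∷ N ++ A ++ B × length N ≡ q × length B ≡ β ×
    All (λ v → R₁ u v ≡ true) N × All (λ v → R₂ u v ≡ true) B
common-large-outdegree {R₁ = R₁} S₁ S₂ q β U U! 1≤q 1≤β l
  with good , bad , r , gd , bd ← separate (λ u → q + β ≤? count (R₁ u) U) U
  with few ← few-small-outdegrees S₁ (q + β) good bad (≤-trans 1≤q (m≤m+n q β)) (unique-++ʳ good (unique-resp-↭ r U!)) r bd
  with u , B , I , r' , lB , out₂ ← large-outdegree S₂ β good (unique-++ˡ good (unique-resp-↭ r U!)) 1≤β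
         (+-cancelˡ-≤ (2 * (q + β)) _ _ (≤-trans l (≤-trans (≤-reflexive (trans (PermP.↭-length r) (trans (length-++ good) (+-comm (length good) _))))
           (+-monoˡ-≤ (length good) (<⇒≤ few)))))
  with U↭ ← ↭-trans r (↭-trans (PermP.++⁺ʳ bad r') (prep u (PermP.++-assoc B I bad)))
  with O , J , r₁ , lO , out₁ ← select (R₁ u) (I ++ bad)
  with N , O₂ , refl , lN ← trim q O (≤-trans (outdegree-outside S₁ q B lB U↭ (All.head (PermP.All-resp-↭ r' gd)))
         (≤-reflexive (sym lO))) =
  u , N , O₂ ++ J , B ,
  ↭-trans U↭ (prep u (↭-trans (PermP.++⁺ˡ B r₁)
    (↭-solve 4 (λ b n o j → b ⊕ ((n ⊕ o) ⊕ j) ⊜ n ⊕ ((o ⊕ j) ⊕ b)) ↭-refl B N O₂ J))) ,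
  lN , lB , AllP.++⁻ˡ N out₁ , out₂

-- From lists to functions

unique-tabulate⁻ : ∀ {X : Set} {n} (f : Fin n → X) → Unique (tabulate f) → ∀ {i j} → f i ≡ f j → i ≡ j
unique-tabulate⁻ f u {fzero} {fzero} _ = refl
unique-tabulate⁻ f (a ∷ u) {fzero} {fsuc j} e = ⊥-elim (AllP.tabulate⁻ a j e)
unique-tabulate⁻ f (a ∷ u) {fsuc i} {fzero} e = ⊥-elim (AllP.tabulate⁻ a i (sym e))
unique-tabulate⁻ f (a ∷ u) {fsuc i} {fsuc j} e = cong fsuc (unique-tabulate⁻ (λ i → f (fsuc i)) u e)

module _ {V C : Set} (T : C → V → V → Bool) (TS : ∀ c → Semicomplete (T c)) (End : V → Set) where
  open Rainbow T TS End

  path-functions : ∀ {m} (o : Fin m → Bool) {N cs vs} → Path N (tabulate o) cs vs →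
    ∃[ v ] ∃[ φ ] (∀ i → Arc (o i) (T (φ i)) (v (inject₁ i)) (v (fsuc i))) ×
      tabulate v ≡ vs × tabulate φ ≡ cs × v fzero ∈ N × End (v (fromℕ m))
  path-functions {zero} o (end {v} v∈ e) = (λ _ → v) , (λ ()) , (λ ()) , refl , refl , v∈ , e
  path-functions {suc m} o (step {c = c} {u = u} u∈ a p)
    with v , φ , arcs , refl , refl , v₀∈ , e ← path-functions (λ i → o (fsuc i)) p =
    v' , φ' , arcs' , refl , refl , u∈ , e
    where
    v' : Fin (suc (suc m)) → V
    v' fzero = u
    v' (fsuc i) = v i
    φ' : Fin (suc m) → C
    φ' fzero = c
    φ' (fsuc i) = φ i
    arcs' : ∀ i → Arc (o i) (T (φ' i)) (v' (inject₁ i)) (v' (fsuc i))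
    arcs' fzero = All.lookup a v₀∈
    arcs' (fsuc i) = arcs i

Arc⇒ArcIn : ∀ {n m} (o : OrientedPath m) (T : Fin n → Fin n → Bool) v i →
            Arc (o i) T (v (inject₁ i)) (v (fsuc i)) → ArcIn o T v i
Arc⇒ArcIn o T v i a with o i
... | true = a
... | false = a

tournament-semicomplete : ∀ {n} {T : Fin n → Fin n → Bool} → IsTournament T → Semicomplete T
tournament-semicomplete t = record { irreflexive = IsTournament.irrefl t ; total = λ {u} {v} → IsTournament.total t u v }

-- Size bounds

n<2^n : ∀ n → n < 2 ^ n
n<2^n zero = s≤s z≤n
n<2^n (suc n) = ≤-trans (+-mono-≤ (m^n>0 2 n) (n<2^n n)) (≤-reflexive (cong (2 ^ n +_) (sym (+-identityʳ (2 ^ n)))))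

bracket : ∀ (f : ℕ → ℕ) n → f 0 ≤ n → ∀ N → n < f N → ∃[ L ] f L ≤ n × n < f (suc L)
bracket f n f0≤ zero n< = ⊥-elim (<-irrefl refl (≤-trans n< f0≤))
bracket f n f0≤ (suc N) n< with f N ≤? n
... | yes fN≤ = N , fN≤ , n<
... | no fN≰ = bracket f n f0≤ N (≰⇒> fN≰)

-- Each value is the required bound at the largest exponent allowed.
standard-sizes : ∀ k → Sizes k
standard-sizes k = record
  { Q = 2 ^ (2 * k) * 2 ^ (2 * k)
  ; β = 2 * (2 ^ (2 * k) * 1)
  ; a₀ = 2 * (2 ^ k * (2 ^ (6 * k) * (2 ^ (2 * k) * 2 ^ (2 * k))))
  ; Q≥1 = *-mono-≤ (m^n>0 2 (2 * k)) (m^n>0 2 (2 * k))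
  ; Q≥ = λ j j≤ → *-mono-≤ (^-monoʳ-≤ 2 j≤) (^-monoʳ-≤ 2 j≤)
  ; β≥ = λ j j≤ → *-monoʳ-≤ 2 (*-monoˡ-≤ 1 (^-monoʳ-≤ 2 j≤))
  ; a₀≥ = λ j j≤ → *-monoʳ-≤ 2 (*-monoʳ-≤ (2 ^ k) (*-monoˡ-≤ _ (^-monoʳ-≤ 2 j≤))) }

-- Estimates by powers of a base p: a product adds exponents, a sum of two terms costs one more, and
-- a constant up to 2 ^ j costs j.
module PowerBounds (p : ℕ) (2≤p : 2 ≤ p) where
  private instance
    p≢0 : NonZero p
    p≢0 = >-nonZero (≤-trans (s≤s z≤n) 2≤p)

  scale : ∀ j {c a x} → c ≤ 2 ^ j → x ≤ p ^ a → c * x ≤ p ^ (j + a)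
  scale j {a = a} c≤ x≤ = ≤-trans (*-mono-≤ (≤-trans c≤ (^-monoˡ-≤ j 2≤p)) x≤) (≤-reflexive (sym (^-distribˡ-+-* p j a)))

  product : ∀ {a b x y} → x ≤ p ^ a → y ≤ p ^ b → x * y ≤ p ^ (a + b)
  product {a} {b} x≤ y≤ = ≤-trans (*-mono-≤ x≤ y≤) (≤-reflexive (sym (^-distribˡ-+-* p a b)))

  double : ∀ {a x y} → x ≤ p ^ a → y ≤ p ^ a → x + y ≤ p ^ (1 + a)
  double {a} x≤ y≤ = ≤-trans (+-mono-≤ x≤ y≤) (≤-trans (≤-reflexive (cong (p ^ a +_) (sym (+-identityʳ _))))
    (*-monoˡ-≤ (p ^ a) 2≤p))

  raise : ∀ {a} b {x} → a ≤ b → x ≤ p ^ a → x ≤ p ^ b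
  raise b a≤b x≤ = ≤-trans x≤ (^-monoʳ-≤ p a≤b)

-- Everything is at most a fixed power of 2 ^ k. That suffices, since log₂ n is about k² in the
-- application.
sizes-bound : ∀ k → 1 ≤ k → let open Sizes (standard-sizes k) ; τ = Q + β + a₀ in
  (τ * suc (2 * (6 * k))) * (k + 2) + (τ * (7 * k) + k) ≤ 2 ^ (24 * k) × 2 * (Q + β) + 2 * β ≤ 2 ^ (24 * k)
sizes-bound k 1≤k =
  ≤-trans (raise 24 (≤ᵇ⇒≤ 23 24 _) (double {22} (raise 22 (≤ᵇ⇒≤ 21 22 _) (product {19} {2} (product {14} {5} τ≤ s≤) k+2≤))
    (double {21} (raise 21 (≤ᵇ⇒≤ 18 21 _) (product {14} {4} τ≤ 7k≤)) (raise 21 (≤ᵇ⇒≤ 1 21 _) k≤)))) (≤-reflexive (sym (pow 24))) ,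
  ≤-trans (raise 24 (≤ᵇ⇒≤ 7 24 _) (double {6} (scale 1 {a = 5} ≤-refl (double {4} Q≤ (raise 4 (≤ᵇ⇒≤ 3 4 _) β≤)))
    (raise 6 (≤ᵇ⇒≤ 4 6 _) (scale 1 {a = 3} ≤-refl β≤)))) (≤-reflexive (sym (pow 24)))
  where
  p = 2 ^ k
  open PowerBounds p (^-monoʳ-≤ 2 1≤k)
  open Sizes (standard-sizes k)
  pow : ∀ j → 2 ^ (j * k) ≡ p ^ j
  pow j = trans (cong (2 ^_) (*-comm j k)) (sym (^-*-assoc 2 k j))
  k≤ : k ≤ p ^ 1
  k≤ = ≤-trans (<⇒≤ (n<2^n k)) (≤-reflexive (sym (*-identityʳ p)))
  Q≤ : Q ≤ p ^ 4
  Q≤ = product {2} {2} (≤-reflexive (pow 2)) (≤-reflexive (pow 2))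
  β≤ : β ≤ p ^ 3
  β≤ = scale 1 {a = 2} ≤-refl (≤-reflexive (trans (*-identityʳ _) (pow 2)))
  a₀≤ : a₀ ≤ p ^ 12
  a₀≤ = scale 1 {a = 11} ≤-refl (product {1} {10} (≤-reflexive (sym (*-identityʳ p))) (product {6} {4} (≤-reflexive (pow 6)) Q≤))
  τ≤ : Q + β + a₀ ≤ p ^ 14
  τ≤ = raise 14 (≤ᵇ⇒≤ 13 14 _) (double {12} (raise 12 (≤ᵇ⇒≤ 5 12 _) (double {4} Q≤ (raise 4 (≤ᵇ⇒≤ 3 4 _) β≤))) a₀≤)
  7k≤ : 7 * k ≤ p ^ 4
  7k≤ = scale 3 {a = 1} (≤ᵇ⇒≤ 7 8 _) k≤
  s≤ : suc (2 * (6 * k)) ≤ p ^ 5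
  s≤ = ≤-trans (≤-trans (s≤s (≤-reflexive (sym (*-assoc 2 6 k)))) (+-monoˡ-≤ (12 * k) 1≤k)) (scale 4 {a = 1} (≤ᵇ⇒≤ 13 16 _) k≤)
  k+2≤ : k + 2 ≤ p ^ 2
  k+2≤ = double {1} k≤ (≤-trans (^-monoʳ-≤ 2 1≤k) (≤-reflexive (sym (*-identityʳ p))))

-- Assembly

module Assembly {V C : Set} (T : C → V → V → Bool) (TS : ∀ c → Semicomplete (T c)) (End : V → Set)
                (k : ℕ) (1≤k : 1 ≤ k) (sizes : Sizes k) where
  open Rainbow T TS End
  open Sizes sizes
  open Stages T TS End k 1≤k sizes
  open ColourStage T TS End k 1≤k sizes

  -- The counts leave nothing over. Absorbing t vertices reserves t (2K + 1) colours beyond those of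
  -- the letters; as letters and colours are equally many, exactly that number of colours has to be
  -- absorbed as well.
  complete : let τ = Q + β + a₀ in ∀ m w Cs N A B →
    (τ * suc (2 * (6 * k))) * (k + 2) + (τ * (7 * k) + k) ≤ m → Mixed k w →
    length w ≡ m → length Cs ≡ m → length N ≡ Q → length B ≡ β → length (N ++ A ++ B) ≡ suc m →
    All End B → Unique (N ++ A ++ B) → Completion N (N ++ A ++ B) w Cs
  complete m w Cs N A B m≥ mx |w| |Cs| lN lB l ends U! = colour-stage (t * suc (2 * (6 * k))) t w Cs N A B mx
      (≤-trans (+-mono-≤ (*-monoˡ-≤ (k + 2) (*-monoˡ-≤ (suc (2 * (6 * k))) t≤τ)) (+-monoˡ-≤ k (*-monoˡ-≤ (7 * k) t≤τ)))
        (≤-trans m≥ (≤-reflexive (sym |w|))))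
      (≤-reflexive (cong (_+ t * suc (2 * (6 * k))) (trans |w| (sym |Cs|)))) ≤-refl lN A≥ lB (≤-reflexive suc-t) ends U!
    where
    t : ℕ
    -- The path has one vertex more than arcs, so m = |A| + Q + β - 1; keeping a₀ vertices of A free
    -- then leaves this many to be absorbed.
    t = (Q + β + a₀) ∸ 1
    suc-t : suc t ≡ Q + β + a₀
    suc-t = m+[n∸m]≡n (≤-trans Q≥1 (≤-trans (m≤m+n Q β) (m≤m+n _ a₀)))
    t≤τ : t ≤ Q + β + a₀
    t≤τ = ≤-trans (n≤1+n t) (≤-reflexive suc-t)
    |A| : suc m ≡ Q + (length A + β)
    |A| = trans (sym l) (trans (length-++ N) (cong₂ _+_ lN (trans (length-++ A) (cong (length A +_) lB))))
    A≥ : length w + a₀ ≤ length A + t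
    A≥ = ≤-reflexive (suc-injective (trans (cong (λ z → suc z + a₀) |w|) (trans (cong (_+ a₀) |A|)
      (trans (regroup Q (length A) β a₀) (trans (cong (length A +_) (sym suc-t)) (+-suc (length A) t))))))
      where
      regroup : ∀ q a b c → (q + (a + b)) + c ≡ a + (q + b + c)
      regroup = solve-∀

  complete-path : let τ = Q + β + a₀ in ∀ {b c} m w Cs u N A B →
    (τ * suc (2 * (6 * k))) * (k + 2) + (τ * (7 * k) + k) ≤ m → Mixed k w →
    length w ≡ m → length Cs ≡ m → length N ≡ Q → length B ≡ β → length (N ++ A ++ B) ≡ suc m →
    All (Arc b (T c) u) N → All End B → Unique (u ∷ N ++ A ++ B) → Unique (c ∷ Cs) →
    ∃[ cs ] ∃[ vs ] Path [ u ] (b ∷ w) (c ∷ cs) (u ∷ vs) × Unique (c ∷ cs) × Unique (u ∷ vs)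
  complete-path {b} {c} m w Cs u N A B m≥ mx |w| |Cs| lN lB l out ends U! C!
    with completion vs cs W E p vr cr ← complete m w Cs N A B m≥ mx |w| |Cs| lN lB l ends (unique-++ʳ [ u ] U!) =
    cs , vs , step (here refl) out p ,
    unique-++ˡ (c ∷ cs) (unique-resp-↭ (prep c (↭-sym cr)) C!) ,
    unique-++ˡ (u ∷ vs) (unique-resp-↭ (prep u (↭-sym vr)) U!)

path⇒rainbow-copy : ∀ {m} (T : Fin (suc m) → Fin (suc m) → Fin (suc m) → Bool)
  (TS : ∀ (c : Fin m) → Semicomplete (T (inject₁ c))) (o : OrientedPath m) u {cs vs} →
  Rainbow.Path (λ c → T (inject₁ c)) TS (λ v → T (fromℕ m) u v ≡ true) [ u ] (tabulate o) cs vs → Unique cs → Unique vs →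
  ∃[ v ] ∃[ φ ] (RainbowCopy T inject₁ o v φ × T (fromℕ m) (v fzero) (v (fromℕ m)) ≡ true)
path⇒rainbow-copy {m} T TS o u p cs! vs!
  with v , φ , arcs , refl , refl , here v₀ , fin ← path-functions (λ c → T (inject₁ c)) TS (λ v → T (fromℕ m) u v ≡ true) o p =
  v , φ , record
    { v-inj = unique-tabulate⁻ v vs!
    ; φ-inj = unique-tabulate⁻ φ cs!
    ; arcs-ok = λ i → Arc⇒ArcIn o (T (inject₁ (φ i))) v i (arcs i) } ,
  -- `End` speaks of the fixed vertex u, which is the first vertex of the copy.
  subst (λ z → T (fromℕ m) z (v (fromℕ m)) ≡ true) (sym v₀) fin

-- Colour `fzero` is spent on the first arc, which leaves u; the m other colours serve the m
-- remaining arcs, and the last colour only defines `End`.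
rainbow-copy : ∀ k (1≤k : 1 ≤ k) (sizes : Sizes k) → let open Sizes sizes ; τ = Q + β + a₀ in
  ∀ m → (τ * suc (2 * (6 * k))) * (k + 2) + (τ * (7 * k) + k) ≤ m → 2 * (Q + β) + 2 * β ≤ m →
  (T : Fin (2 + m) → Fin (2 + m) → Fin (2 + m) → Bool) → (∀ c → IsTournament (T c)) →
  (o : OrientedPath (suc m)) → Mixed k (tabulate o) →
  ∃[ v ] ∃[ φ ] (RainbowCopy T inject₁ o v φ × T (fromℕ (suc m)) (v fzero) (v (fromℕ (suc m))) ≡ true)
rainbow-copy k 1≤k sizes m m≥ m≥' T tour o mx = from-start (common-large-outdegree
    (dir-semicomplete (o fzero) (TS fzero)) (tournament-semicomplete (tour (fromℕ (suc m)))) Q β (allFin (2 + m)) V! Q≥1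
    (≤-trans (s≤s z≤n) (β≥ 0 z≤n)) (≤-trans m≥' (≤-trans (m≤n+m m 2) (≤-reflexive (sym |V|)))))
  where
  open Sizes sizes
  T' : Fin (suc m) → Fin (2 + m) → Fin (2 + m) → Bool
  T' c = T (inject₁ c)
  TS : ∀ c → Semicomplete (T' c)
  TS c = tournament-semicomplete (tour (inject₁ c))
  V! : Unique (allFin (2 + m))
  V! = allFin⁺ (2 + m)
  |V| : length (allFin (2 + m)) ≡ 2 + m
  |V| = length-tabulate {n = 2 + m} (λ i → i)

  from-start : (∃[ u ] ∃[ N ] ∃[ A ] ∃[ B ] allFin (2 + m) ↭ u ∷ N ++ A ++ B × length N ≡ Q × length B ≡ β ×
      All (λ v → dir (o fzero) (T' fzero) u v ≡ true) N × All (λ v → T (fromℕ (suc m)) u v ≡ true) B) →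
    ∃[ v ] ∃[ φ ] (RainbowCopy T inject₁ o v φ × T (fromℕ (suc m)) (v fzero) (v (fromℕ (suc m))) ≡ true)
  from-start (u , N , A , B , U↭ , lN , lB , outN , outB) = from-path (Assembly.complete-path T' TS End k 1≤k sizes
      m (tabulate (λ i → o (fsuc i))) (tabulate fsuc) u N A B m≥ (Mixed-++ʳ [ o fzero ] mx)
      (length-tabulate (λ i → o (fsuc i))) (length-tabulate fsuc) lN lB
      (suc-injective (trans (sym (PermP.↭-length U↭)) |V|)) outN outB (unique-resp-↭ U↭ V!) (allFin⁺ (suc m)))
    where
    End : Fin (2 + m) → Set
    End v = T (fromℕ (suc m)) u v ≡ true
    from-path : (∃[ cs ] ∃[ vs ] Rainbow.Path T' TS End [ u ] (tabulate o) (fzero ∷ cs) (u ∷ vs) ×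
        Unique (fzero ∷ cs) × Unique (u ∷ vs)) →
      ∃[ v ] ∃[ φ ] (RainbowCopy T inject₁ o v φ × T (fromℕ (suc m)) (v fzero) (v (fromℕ (suc m))) ≡ true)
    from-path (cs , vs , p , cs! , vs!) = path⇒rainbow-copy T TS o u p cs! vs!

-- For L at least 26, L² is at least 24L + 2L and so at least 24 (L + 1) + 1. The spare factor 2
-- covers the two vertices in excess of m'.
large-enough : ∀ L k m → k ≡ suc L → 26 ≤ L → 2 ^ (L * L) ≤ suc m → ∃[ m' ] m ≡ suc m' × 2 ^ (24 * k) ≤ m'
large-enough L k m refl 26≤L h = go m (≤-trans (+-mono-≤ (^-monoʳ-≤ 2 {1} {24 * suc L} (s≤s z≤n)) (m≤m+n x 0)) (≤-trans (^-monoʳ-≤ 2 exponent) h))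
  where
  x = 2 ^ (24 * suc L)
  exponent : suc (24 * suc L) ≤ L * L
  exponent = ≤-trans (≤-trans (≤-reflexive (l L)) (+-monoʳ-≤ (24 * L) (≤-trans (≤ᵇ⇒≤ 25 52 _) (*-monoʳ-≤ 2 26≤L))))
    (≤-trans (≤-reflexive (l' L)) (*-monoˡ-≤ L 26≤L))
    where
    l : ∀ L → suc (24 * suc L) ≡ 24 * L + 25
    l = solve-∀
    l' : ∀ L → 24 * L + 2 * L ≡ 26 * L
    l' = solve-∀
  go : ∀ m → 2 + x ≤ suc m → ∃[ m' ] m ≡ suc m' × x ≤ m'
  go (suc m') (s≤s (s≤s le)) = m' , refl , le

square-mono : ∀ {a b} → a ≤ b → 2 ^ (a * a) ≤ 2 ^ (b * b)
square-mono a≤b = ^-monoʳ-≤ 2 (*-mono-≤ a≤b a≤b)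

-- The inequality 2 ^ (L * L) ≤ n says that L is at most the square root of log₂ n. As k already
-- violates it, every block is shorter than k.
short-block-copy : ∀ L k m → k ≡ suc L → 26 ≤ L → 2 ^ (L * L) ≤ suc m → suc m < 2 ^ (k * k) →
  (T : Fin (suc m) → Fin (suc m) → Fin (suc m) → Bool) → (∀ c → IsTournament (T c)) →
  (o : OrientedPath m) → (∀ i L → IsBlock o i L → 2 ^ (L * L) ≤ suc m) →
  ∃[ v ] ∃[ φ ] (RainbowCopy T inject₁ o v φ × T (fromℕ m) (v fzero) (v (fromℕ m)) ≡ true)
short-block-copy L k m k≡ 26≤L L≤ <k T tour o blocks with m' , refl , m'≥ ← large-enough L k m k≡ 26≤L L≤ =
  rainbow-copy k 1≤k (standard-sizes k) m' (≤-trans (proj₁ (sizes-bound k 1≤k)) m'≥) (≤-trans (proj₂ (sizes-bound k 1≤k)) m'≥)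
    T tour o (short-blocks⇒Mixed o k 1≤k λ i L' blk →
      ≰⇒> λ k≤L' → <-irrefl refl (≤-trans <k (≤-trans (square-mono k≤L') (blocks i L' blk))))
  where
  1≤k : 1 ≤ k
  1≤k = ≤-trans (s≤s z≤n) (≤-reflexive (sym k≡))

-- L is the integer part of the square root of log₂ n.
square-bracket : ∀ r m → 2 ^ (r * r) ≤ suc m → ∃[ L ] r ≤ L × 2 ^ (L * L) ≤ suc m × suc m < 2 ^ (suc L * suc L)
square-bracket r m h with L , L≤ , <L ← bracket (λ L → 2 ^ (L * L)) (suc m) (s≤s z≤n) (suc m)
    (≤-trans (n<2^n (suc m)) (^-monoʳ-≤ 2 (m≤m+n (suc m) (m * suc m)))) =
  L , ≮⇒≥ (λ L<r → <-irrefl refl (≤-trans <L (≤-trans (square-mono L<r) h))) , L≤ , <L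

theorem2p1 : ∃[ n₀ ] ∀ (m : ℕ) → n₀ ≤ suc m →
    (T : Fin (suc m) → Fin (suc m) → Fin (suc m) → Bool) →
    (∀ c → IsTournament (T c)) →
    (o : OrientedPath m) →
    (∀ i L → IsBlock o i L → 2 ^ (L * L) ≤ suc m) →
    ∃[ v ] ∃[ φ ] (RainbowCopy T inject₁ o v φ
    × T (fromℕ m) (v fzero) (v (fromℕ m)) ≡ true)
-- This threshold yields 26 ≤ L, as `large-enough` demands.
theorem2p1 = 2 ^ (26 * 26) , λ m n₀≤ → let L , 26≤L , L≤ , <L = square-bracket 26 m n₀≤ in
  short-block-copy L (suc L) m refl 26≤L L≤ <L
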